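{- Let $K$ be a field and let $\mathcal{P}\subset \mathbb{R}_{\ge 0}^n$ be an anti-blocking lattice polytope of dimension $n$, and let $\mathcal{P}^{\pm}=\{\varepsilon\mathbf{x} : \varepsilon\in\{ -1,1\}^n,\ \mathbf{x}\in\mathcal{P}\}$. Then the toric ring $K[\mathcal{P}]$ is normal if and only if the toric ring $K[\mathcal{P}^{\pm}]$ is normal.
   Context: A lattice polytope is a convex polytope whose vertices have integer coordinates. A lattice polytope $\mathcal{P}\subset\mathbb{R}_{\ge0}^n$ of dimension $n$ is anti-blocking if for every $\mathbf{y}\in\mathcal{P}$ and every $\mathbf{x}\in\mathbb{R}^n$ with $0\le x_i\le y_i$ for all $i$, one has $\mathbf{x}\in\mathcal{P}$. For $\varepsilon=(\varepsilon_1,\dots,\varepsilon_n)\in\{ -1,1\}^n$ and $\mathbf{x}\in\mathbb{R}^n$, $\varepsilon\mathbf{x}:=(\varepsilon_1x_1,\dots,\varepsilon_nx_n)$; $\mathcal{P}^{\pm}$ is then a convex lattice polytope. For a lattice polytope $\mathcal{Q}\subset\mathbb{R}^n$ with $\mathcal{Q}\cap\mathbb{Z}^n=\{\mathbf{a}_1,\dots,\mathbf{a}_m\}$, the toric ring $K[\mathcal{Q}]$ is the subalgebra of the Laurent polynomial ring $K[t_1^{\pm1},\dots,t_n^{\pm1},s]$ generated by $\mathbf{t}^{\mathbf{a}_1}s,\dots,\mathbf{t}^{\mathbf{a}_m}s$, where $\mathbf{t}^{\mathbf{a}}=t_1^{a_1}\cdots t_n^{a_n}$. -}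

module Defs where

open import Level using (Level; _⊔_) renaming (suc to lsuc)
open import Algebra.Bundles using (CommutativeRing)
open import Data.Nat as ℕ using (ℕ; zero; suc)
open import Data.Integer as ℤ using (ℤ)
import Data.Integer.Properties as ℤP
open import Data.Rational as ℚ using (ℚ; 0ℚ; 1ℚ)
open import Data.Fin using (Fin; zero; suc)
import Data.Fin
open import Data.Vec as V using (Vec; []; _∷_)
import Data.Vec.Properties as VP
open import Data.List as L using (List; []; _∷_; _++_)
open import Data.List.Relation.Unary.All using (All)
open import Data.Product using (Σ; ∃; _×_; _,_)
import Data.Product.Properties as PP
open import Data.Sign using (Sign)
open import Relation.Nullary using (¬_; does)
open import Relation.Binary.PropositionalEquality using (_≡_)
open import Data.Bool using (if_then_else_)

record Field (c ℓ : Level) : Set (lsuc (c ⊔ ℓ)) where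
  field
    commutativeRing : CommutativeRing c ℓ
  open CommutativeRing commutativeRing public
  field
    0≉1     : ¬ (0# ≈ 1#)
    inverse : ∀ x → ¬ (x ≈ 0#) → ∃ λ y → (x * y) ≈ 1#

-- Geometry in ℚ^n.  A lattice polytope is the convex hull of finitely
-- many integer points; it is given by a vector of vertices.

ℚⁿ : ℕ → Set
ℚⁿ n = Vec ℚ n

toℚⁿ : ∀ {n} → Vec ℤ n → ℚⁿ n
toℚⁿ = V.map (λ z → z ℚ./ 1)

0ᵥ : ∀ {n} → ℚⁿ n
0ᵥ = V.replicate _ 0ℚ

_+ᵥ_ : ∀ {n} → ℚⁿ n → ℚⁿ n → ℚⁿ n
_+ᵥ_ = V.zipWith ℚ._+_

_-ᵥ_ : ∀ {n} → ℚⁿ n → ℚⁿ n → ℚⁿ n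
x -ᵥ y = V.zipWith ℚ._-_ x y

_·ᵥ_ : ∀ {n} → ℚ → ℚⁿ n → ℚⁿ n
c ·ᵥ x = V.map (c ℚ.*_) x

Σℚ : ∀ {m} → (Fin m → ℚ) → ℚ
Σℚ {zero}  f = 0ℚ
Σℚ {suc m} f = f zero ℚ.+ Σℚ (λ i → f (suc i))

Σᵥ : ∀ {m n} → (Fin m → ℚⁿ n) → ℚⁿ n
Σᵥ {zero}  f = 0ᵥ
Σᵥ {suc m} f = f zero +ᵥ Σᵥ (λ i → f (suc i))

Conv : ∀ {n m} → Vec (Vec ℤ n) m → ℚⁿ n → Set
Conv {n} {m} vs x =
  Σ (Fin m → ℚ) λ w →
    (∀ j → 0ℚ ℚ.≤ w j) × (Σℚ w ≡ 1ℚ) ×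
    (x ≡ Σᵥ (λ j → w j ·ᵥ toℚⁿ (V.lookup vs j)))

AntiBlocking : ∀ {n} → (ℚⁿ n → Set) → Set
AntiBlocking {n} P =
  (∀ x → P x → ∀ (i : Fin n) → 0ℚ ℚ.≤ V.lookup x i) ×
  (∀ y x → P y →
     (∀ (i : Fin n) → (0ℚ ℚ.≤ V.lookup x i) × (V.lookup x i ℚ.≤ V.lookup y i)) →
     P x)

LinIndep : ∀ {m n} → (Fin m → ℚⁿ n) → Set
LinIndep {m} v = ∀ (c : Fin m → ℚ) → Σᵥ (λ j → c j ·ᵥ v j) ≡ 0ᵥ → ∀ j → c j ≡ 0ℚ

HasDim : ∀ {n} → (ℚⁿ n → Set) → Set
HasDim {n} P =
  Σ (Fin (suc n) → ℚⁿ n) λ p →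
    (∀ i → P (p i)) × LinIndep (λ (i : Fin n) → p (suc i) -ᵥ p zero)

signℚ : Sign → ℚ → ℚ
signℚ Sign.+ q = q
signℚ Sign.- q = ℚ.- q

_⊙_ : ∀ {n} → Vec Sign n → ℚⁿ n → ℚⁿ n
ε ⊙ x = V.zipWith signℚ ε x

_^± : ∀ {n} → (ℚⁿ n → Set) → ℚⁿ n → Set
_^± {n} P y = Σ (Vec Sign n) λ ε → Σ (ℚⁿ n) λ x → P x × (y ≡ ε ⊙ x)

-- Laurent polynomial ring K[t₁^{±1},…,tₙ^{±1}, s].
-- An element is a finite list of terms (coefficient, (exponent of t, exponent of s));
-- two lists are equal as polynomials if all coefficients agree.

module Laurent {c ℓ} (K : Field c ℓ) (n : ℕ) where
  open Field K using (Carrier; _≈_; _+_; _*_; 0#; 1#)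

  Exp : Set
  Exp = Vec ℤ n × ℕ

  _≟ₑ_ : (e e′ : Exp) → _
  _≟ₑ_ = PP.≡-dec (VP.≡-dec ℤP._≟_) ℕ._≟_

  _+ₑ_ : Exp → Exp → Exp
  (a , k) +ₑ (b , l) = V.zipWith ℤ._+_ a b , k ℕ.+ l

  0ₑ : Exp
  0ₑ = V.replicate n (ℤ.+ 0) , 0

  LP : Set c
  LP = List (Carrier × Exp)

  coeff : LP → Exp → Carrier
  coeff []             e = 0#
  coeff ((a , e′) ∷ p) e = if does (e′ ≟ₑ e) then a + coeff p e else coeff p e

  _≈ₗ_ : LP → LP → Set ℓ
  p ≈ₗ q = ∀ e → coeff p e ≈ coeff q e

  0ₗ : LP
  0ₗ = []

  1ₗ : LP
  1ₗ = (1# , 0ₑ) ∷ []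

  _+ₗ_ : LP → LP → LP
  _+ₗ_ = _++_

  _*ₗ_ : LP → LP → LP
  p *ₗ q = L.concatMap (λ { (a , e) → L.map (λ { (b , e′) → (a * b , e +ₑ e′) }) q }) p

  _^ₗ_ : LP → ℕ → LP
  p ^ₗ zero  = 1ₗ
  p ^ₗ suc k = p *ₗ (p ^ₗ k)

  Σₗ : ∀ {m} → (Fin m → LP) → LP
  Σₗ {zero}  f = 0ₗ
  Σₗ {suc m} f = f zero +ₗ Σₗ (λ i → f (suc i))

  -- (b , k) ∈ semigroup generated by {(a , 1) : a ∈ Q ∩ ℤⁿ}:
  -- t^b s^k is a product of k generators t^a s of K[Q]
  data InMonoid (Q : ℚⁿ n → Set) : Exp → Set where
    [] : InMonoid Q 0ₑ
    _∷_ : ∀ {a e} → Q (toℚⁿ a) → InMonoid Q e → InMonoid Q ((a , 1) +ₑ e)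

  -- membership in the toric ring K[Q] (the K-subalgebra generated by the
  -- t^a s with a ∈ Q ∩ ℤⁿ)
  InToric : (ℚⁿ n → Set) → LP → Set (c ⊔ ℓ)
  InToric Q f = Σ LP λ p → All (λ { (_ , e) → InMonoid Q e }) p × (p ≈ₗ f)

  -- K[Q] (a domain, being a subring of the Laurent polynomial ring) is
  -- normal: every element f/g (f, g ∈ K[Q], g ≠ 0) of its fraction field
  -- that is a root of a monic polynomial X^d + Σ_{i<d} cᵢ Xⁱ with cᵢ ∈ K[Q]
  -- lies in K[Q].  (The equation is cleared of denominators by g^d.)
  IsNormal : (ℚⁿ n → Set) → Set (c ⊔ ℓ)
  IsNormal Q =
    ∀ f g → InToric Q f → InToric Q g → ¬ (g ≈ₗ 0ₗ) →
    ∀ (d : ℕ) (cs : Fin d → LP) → (∀ i → InToric Q (cs i)) →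
    ((f ^ₗ d) +ₗ Σₗ (λ i → cs i *ₗ ((f ^ₗ Data.Fin.toℕ i) *ₗ (g ^ₗ (d ℕ.∸ Data.Fin.toℕ i))))) ≈ₗ 0ₗ →
    Σ LP λ h → InToric Q h × (f ≈ₗ (h *ₗ g))

{-# OPTIONS --safe #-}
module Submission where

-- Let M and M± be the monoids of the monomials of K[P] and K[P±].  Since P is anti-blocking,
-- (a , k) ∈ M± iff (∣a∣ , k) ∈ M.  The key step: suppose h g = f and f/g is integral over
-- K[Q].  If a linear weight is nonnegative on the monoid of Q, then the terms of h of negative
-- weight are killed by g, hence may be dropped from h: order monomials by weight and compare
-- the lowest coefficients in the integral equation.  If K[P±] is normal and f, g ∈ K[P], the
-- quotient h ∈ K[P±] is thus pruned to K[P] using the coordinates as weights.  Conversely,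
-- normality of K[P] makes M saturated, so by Farkas' lemma every monomial outside M± is
-- separated from M± by a weight; a quotient f/g over K[P±] is moved into K[P] by multiplying
-- with a deep monomial, computed there, and pruned.
--
-- Equality in K is neither decidable nor stable, so there is no division algorithm for
-- polynomials: the assumed normality is the only source of quotients and of reducedness of K.

open import Defs
open import Algebra.Bundles using (CommutativeRing; CommutativeMonoid; AbelianGroup)
open import Data.Empty using (⊥; ⊥-elim)
open import Data.Bool using (true; false; if_then_else_)
open import Data.Fin using (Fin; zero; suc; toℕ)
import Data.Fin.Properties as FinP
open import Data.Integer as ℤ using (ℤ; +_; -[1+_])
import Data.Integer.Properties as ℤP
open import Data.Integer.Tactic.RingSolver using (solve-∀)
open import Data.List as L using (List; []; _∷_; _++_)
import Data.List.Properties as ListP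
open import Data.List.Membership.Propositional using (find; lose)
open import Data.List.Relation.Unary.All as All using (All; []; _∷_)
import Data.List.Relation.Unary.All.Properties as AllP
open import Data.List.Relation.Unary.Any as Any using (Any; here; there)
open import Data.Nat as ℕ using (ℕ; zero; suc)
import Data.Nat.Coprimality as Coprimality
import Data.Nat.Properties as ℕP
open import Data.Product using (Σ; ∃; _×_; _,_; proj₁; proj₂)
open import Data.Rational as ℚ using (ℚ; 0ℚ; 1ℚ; mkℚ)
import Data.Rational.Properties as ℚP
open import Data.Sign using (Sign)
open import Data.Sum as Sum using (_⊎_; inj₁; inj₂)
open import Data.Vec as V using (Vec; []; _∷_)
import Data.Vec.Properties as VP
open import Function using (_∘_; id)
open import Function.Bundles using (_⇔_; mk⇔)
open import Level using (_⊔_)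
open import Relation.Binary using (tri<; tri≈; tri>)
open import Relation.Binary.PropositionalEquality as ≡ using (_≡_; refl; sym; trans; cong; cong₂; subst)
open import Relation.Nullary using (¬_; Dec; yes; no; does)
open import Relation.Nullary.Decidable using (¬?; dec-true; dec-false)
open import Relation.Unary using (Decidable)

-- Pruning is a valuation bound: if each coefficient cᵢ of a monic equation of degree d has weight
-- at least (d - i) θ, then a root should have weight at least θ. The threshold is 0 when the
-- coefficients lie in K[P]. When they are the y^(d - i) cᵢ of the equation for y (f/g), it is the
-- weight of y; what survives is then y times monomials of M±, so that y can be divided out term by
-- term. The conclusion is not that the light terms of h vanish: g ≉ 0 is a bare negation and
-- exhibits no coefficient to cancel. They are only shown to be annihilated by g. This suffices,
-- since normality asks for h g = f and not for a particular h. For the same reason non-membership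
-- in a monoid is of no use as a negation: each exponent must either be a member or come with a
-- separating weight. Farkas' lemma supplies this alternative, and since membership in M± depends on
-- absolute values alone, it is applied to the cone over P.

-- Laurent polynomials as a commutative ring

module Polynomials {c ℓ} (K : Field c ℓ) (n : ℕ) where
  open Laurent K n
  module K = Field K
  open K using (Carrier; _≈_; _+_; _*_; 0#; 1#)
  open import Algebra.Properties.Ring K.ring using (-‿distribˡ-*; -0#≈0#; -‿+-comm)
  open import Algebra.Properties.CommutativeSemigroup K.+-commutativeSemigroup using ()
    renaming (interchange to +-interchange; x∙yz≈y∙xz to +-x∙yz≈y∙xz)
  open import Algebra.Properties.CommutativeSemigroup K.*-commutativeSemigroup using (x∙yz≈y∙xz)
  import Relation.Binary.Reasoning.Setoid as SetoidReasoning
  open SetoidReasoning K.setoid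

  +ₑ-comm : ∀ a b → a +ₑ b ≡ b +ₑ a
  +ₑ-comm (a , k) (b , l) = cong₂ _,_ (VP.zipWith-comm ℤP.+-comm a b) (ℕP.+-comm k l)

  +ₑ-assoc : ∀ a b c → (a +ₑ b) +ₑ c ≡ a +ₑ (b +ₑ c)
  +ₑ-assoc (a , k) (b , l) (c , m) = cong₂ _,_ (VP.zipWith-assoc ℤP.+-assoc a b c) (ℕP.+-assoc k l m)

  +ₑ-identityˡ : ∀ a → 0ₑ +ₑ a ≡ a
  +ₑ-identityˡ (a , k) = cong (_, k) (VP.zipWith-identityˡ ℤP.+-identityˡ a)

  +ₑ-identityʳ : ∀ a → a +ₑ 0ₑ ≡ a
  +ₑ-identityʳ a = trans (+ₑ-comm a 0ₑ) (+ₑ-identityˡ a)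

  zipWith-+-cancelˡ : ∀ {m} (a b c : Vec ℤ m) → V.zipWith ℤ._+_ a b ≡ V.zipWith ℤ._+_ a c → b ≡ c
  zipWith-+-cancelˡ []      []      []      _  = refl
  zipWith-+-cancelˡ (x ∷ a) (y ∷ b) (z ∷ c) eq =
    cong₂ _∷_ (∙-cancelˡ x y z (VP.∷-injectiveˡ eq)) (zipWith-+-cancelˡ a b c (VP.∷-injectiveʳ eq))
    where open import Algebra.Properties.Group (AbelianGroup.group ℤP.+-0-abelianGroup) using (∙-cancelˡ)

  +ₑ-cancelˡ : ∀ a {b c} → a +ₑ b ≡ a +ₑ c → b ≡ c
  +ₑ-cancelˡ (a , k) {b , l} {c , m} eq =
    cong₂ _,_ (zipWith-+-cancelˡ a b c (cong proj₁ eq)) (ℕP.+-cancelˡ-≡ k l m (cong proj₂ eq))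

  expMonoid : CommutativeMonoid _ _
  expMonoid = record
    { Carrier = Exp ; _≈_ = _≡_ ; _∙_ = _+ₑ_ ; ε = 0ₑ
    ; isCommutativeMonoid = record
      { isMonoid = record
        { isSemigroup = record
          { isMagma = record { isEquivalence = ≡.isEquivalence ; ∙-cong = cong₂ _+ₑ_ }
          ; assoc = +ₑ-assoc }
        ; identity = +ₑ-identityˡ , +ₑ-identityʳ }
      ; comm = +ₑ-comm } }

  open import Algebra.Properties.CommutativeSemigroup (CommutativeMonoid.commutativeSemigroup expMonoid) public
    using () renaming (interchange to +ₑ-interchange)

  -- The linear functional t^e ↦ φ e applied to p.  Two lists are equal as polynomials
  -- iff no functional separates them, and products become iterated evaluations, so
  -- the ring axioms reduce to rearrangements of finite sums.
  eval : LP → (Exp → Carrier) → Carrier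
  eval []            φ = 0#
  eval ((a , e) ∷ p) φ = a * φ e + eval p φ

  eval-cong-All : ∀ {p φ ψ} → All (λ t → φ (proj₂ t) ≈ ψ (proj₂ t)) p → eval p φ ≈ eval p ψ
  eval-cong-All []         = K.refl
  eval-cong-All (eq ∷ eqs) = K.+-cong (K.*-congˡ eq) (eval-cong-All eqs)

  eval-cong : ∀ p {φ ψ} → (∀ e → φ e ≈ ψ e) → eval p φ ≈ eval p ψ
  eval-cong p eq = eval-cong-All (All.universal (λ t → eq (proj₂ t)) p)

  eval-++ : ∀ p q φ → eval (p ++ q) φ ≈ eval p φ + eval q φ
  eval-++ []            q φ = K.sym (K.+-identityˡ _)
  eval-++ ((a , e) ∷ p) q φ = K.trans (K.+-congˡ (eval-++ p q φ)) (K.sym (K.+-assoc _ _ _))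

  eval-zero : ∀ p → eval p (λ _ → 0#) ≈ 0#
  eval-zero []            = K.refl
  eval-zero ((a , e) ∷ p) = K.trans (K.+-cong (K.zeroʳ a) (eval-zero p)) (K.+-identityˡ 0#)

  eval-+ : ∀ p φ ψ → eval p (λ e → φ e + ψ e) ≈ eval p φ + eval p ψ
  eval-+ []            φ ψ = K.sym (K.+-identityˡ 0#)
  eval-+ ((a , e) ∷ p) φ ψ = K.trans (K.+-cong (K.distribˡ a _ _) (eval-+ p φ ψ)) (+-interchange _ _ _ _)

  eval-* : ∀ p x φ → eval p (λ e → x * φ e) ≈ x * eval p φ
  eval-* []            x φ = K.sym (K.zeroʳ x)
  eval-* ((a , e) ∷ p) x φ = K.trans (K.+-cong (x∙yz≈y∙xz a x (φ e)) (eval-* p x φ)) (K.sym (K.distribˡ x _ _))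

  eval-swap : ∀ p q (χ : Exp → Exp → Carrier) →
              eval p (λ e → eval q (χ e)) ≈ eval q (λ e′ → eval p (λ e → χ e e′))
  eval-swap []            q χ = K.sym (eval-zero q)
  eval-swap ((a , e) ∷ p) q χ = K.sym (K.trans (eval-+ q _ _)
    (K.+-cong (eval-* q a _) (K.sym (eval-swap p q χ))))

  eval-*ₗ : ∀ p q φ → eval (p *ₗ q) φ ≈ eval p (λ e → eval q (λ e′ → φ (e +ₑ e′)))
  eval-*ₗ []            q φ = K.refl
  eval-*ₗ ((a , e) ∷ p) q φ = K.trans (eval-++ (L.map _ q) (p *ₗ q) φ)
    (K.+-cong (row q) (eval-*ₗ p q φ))
    where
    row : ∀ r → eval (L.map (λ { (b , e′) → (a * b , e +ₑ e′) }) r) φ ≈ a * eval r (λ e′ → φ (e +ₑ e′))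
    row []             = K.sym (K.zeroʳ a)
    row ((b , e′) ∷ r) = K.trans (K.+-cong (K.*-assoc a b _) (row r)) (K.sym (K.distribˡ a _ _))

  infix 4 _≋_
  -- Being a record, it lets unification recover p and q. The ring axioms are proved for this
  -- relation; `≋⇒≈ₗ` and `≈ₗ⇒≋` identify it with equality of coefficients.
  record _≋_ (p q : LP) : Set (c ⊔ ℓ) where
    constructor extensional
    field at : ∀ φ → eval p φ ≈ eval q φ
  open _≋_ public

  -ₗ_ : LP → LP
  -ₗ p = L.map (λ t → K.- proj₁ t , proj₂ t) p

  eval-neg : ∀ p φ → eval (-ₗ p) φ ≈ K.- eval p φ
  eval-neg []            φ = K.sym -0#≈0#
  eval-neg ((a , e) ∷ p) φ = K.trans (K.+-cong (K.sym (-‿distribˡ-* a _)) (eval-neg p φ)) (-‿+-comm _ _)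

  *ₗ-cong : ∀ {p p′ q q′} → p ≋ p′ → q ≋ q′ → p *ₗ q ≋ p′ *ₗ q′
  *ₗ-cong {p} {p′} {q} {q′} eq eq′ = extensional λ φ → begin
    eval (p *ₗ q) φ                                 ≈⟨ eval-*ₗ p q φ ⟩
    eval p (λ e → eval q (λ e′ → φ (e +ₑ e′)))      ≈⟨ at eq _ ⟩
    eval p′ (λ e → eval q (λ e′ → φ (e +ₑ e′)))     ≈⟨ eval-cong p′ (λ e → at eq′ _) ⟩
    eval p′ (λ e → eval q′ (λ e′ → φ (e +ₑ e′)))    ≈⟨ K.sym (eval-*ₗ p′ q′ φ) ⟩
    eval (p′ *ₗ q′) φ                               ∎

  *ₗ-comm : ∀ p q → p *ₗ q ≋ q *ₗ p
  *ₗ-comm p q = extensional λ φ → begin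
    eval (p *ₗ q) φ                               ≈⟨ eval-*ₗ p q φ ⟩
    eval p (λ e → eval q (λ e′ → φ (e +ₑ e′)))    ≈⟨ eval-swap p q _ ⟩
    eval q (λ e′ → eval p (λ e → φ (e +ₑ e′)))    ≈⟨ eval-cong q (λ e′ → eval-cong p (λ e → K.reflexive (cong φ (+ₑ-comm e e′)))) ⟩
    eval q (λ e′ → eval p (λ e → φ (e′ +ₑ e)))    ≈⟨ K.sym (eval-*ₗ q p φ) ⟩
    eval (q *ₗ p) φ                               ∎

  *ₗ-assoc : ∀ p q r → (p *ₗ q) *ₗ r ≋ p *ₗ (q *ₗ r)
  *ₗ-assoc p q r = extensional λ φ → begin
    eval ((p *ₗ q) *ₗ r) φ
      ≈⟨ eval-*ₗ (p *ₗ q) r φ ⟩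
    eval (p *ₗ q) (λ e → eval r (λ e″ → φ (e +ₑ e″)))
      ≈⟨ eval-*ₗ p q _ ⟩
    eval p (λ e → eval q (λ e′ → eval r (λ e″ → φ ((e +ₑ e′) +ₑ e″))))
      ≈⟨ eval-cong p (λ e → eval-cong q (λ e′ → eval-cong r (λ e″ → K.reflexive (cong φ (+ₑ-assoc e e′ e″))))) ⟩
    eval p (λ e → eval q (λ e′ → eval r (λ e″ → φ (e +ₑ (e′ +ₑ e″)))))
      ≈⟨ eval-cong p (λ e → K.sym (eval-*ₗ q r _)) ⟩
    eval p (λ e → eval (q *ₗ r) (λ e′ → φ (e +ₑ e′)))
      ≈⟨ K.sym (eval-*ₗ p (q *ₗ r) φ) ⟩
    eval (p *ₗ (q *ₗ r)) φ ∎

  *ₗ-identityˡ : ∀ p → 1ₗ *ₗ p ≋ p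
  *ₗ-identityˡ p = extensional λ φ → begin
    eval (1ₗ *ₗ p) φ                            ≈⟨ eval-*ₗ 1ₗ p φ ⟩
    1# * eval p (λ e → φ (0ₑ +ₑ e)) + 0#        ≈⟨ K.trans (K.+-identityʳ _) (K.*-identityˡ _) ⟩
    eval p (λ e → φ (0ₑ +ₑ e))                  ≈⟨ eval-cong p (λ e → K.reflexive (cong φ (+ₑ-identityˡ e))) ⟩
    eval p φ                                    ∎

  *ₗ-distribʳ : ∀ p q r → (q ++ r) *ₗ p ≋ (q *ₗ p) ++ (r *ₗ p)
  *ₗ-distribʳ p q r = extensional λ φ → begin
    eval ((q ++ r) *ₗ p) φ                ≈⟨ eval-*ₗ (q ++ r) p φ ⟩
    eval (q ++ r) _                       ≈⟨ eval-++ q r _ ⟩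
    eval q _ + eval r _                   ≈⟨ K.sym (K.+-cong (eval-*ₗ q p φ) (eval-*ₗ r p φ)) ⟩
    eval (q *ₗ p) φ + eval (r *ₗ p) φ     ≈⟨ K.sym (eval-++ (q *ₗ p) (r *ₗ p) φ) ⟩
    eval ((q *ₗ p) ++ (r *ₗ p)) φ         ∎

  ++-cong : ∀ {p p′ q q′} → p ≋ p′ → q ≋ q′ → p ++ q ≋ p′ ++ q′
  ++-cong {p} {p′} {q} {q′} eq eq′ = extensional λ φ →
    K.trans (eval-++ p q φ) (K.trans (K.+-cong (at eq φ) (at eq′ φ)) (K.sym (eval-++ p′ q′ φ)))

  ++-comm : ∀ p q → p ++ q ≋ q ++ p
  ++-comm p q = extensional λ φ → K.trans (eval-++ p q φ) (K.trans (K.+-comm _ _) (K.sym (eval-++ q p φ)))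

  -ₗ-inverseˡ : ∀ p → (-ₗ p) ++ p ≋ []
  -ₗ-inverseˡ p = extensional λ φ → K.trans (eval-++ (-ₗ p) p φ) (K.trans (K.+-congʳ (eval-neg p φ)) (K.-‿inverseˡ _))

  -ₗ-cong : ∀ {p q} → p ≋ q → -ₗ p ≋ -ₗ q
  -ₗ-cong {p} {q} eq = extensional λ φ → K.trans (eval-neg p φ) (K.trans (K.-‿cong (at eq φ)) (K.sym (eval-neg q φ)))

  ≋-refl : ∀ {p} → p ≋ p
  ≋-refl = extensional λ φ → K.refl

  ≋-sym : ∀ {p q} → p ≋ q → q ≋ p
  ≋-sym eq = extensional λ φ → K.sym (at eq φ)

  ≋-trans : ∀ {p q r} → p ≋ q → q ≋ r → p ≋ r
  ≋-trans eq eq′ = extensional λ φ → K.trans (at eq φ) (at eq′ φ)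

  ≋-reflexive : ∀ {p q} → p ≡ q → p ≋ q
  ≋-reflexive refl = ≋-refl

  *ₗ-identityʳ : ∀ p → p *ₗ 1ₗ ≋ p
  *ₗ-identityʳ p = ≋-trans (*ₗ-comm p 1ₗ) (*ₗ-identityˡ p)

  *ₗ-distribˡ : ∀ p q r → p *ₗ (q ++ r) ≋ (p *ₗ q) ++ (p *ₗ r)
  *ₗ-distribˡ p q r = ≋-trans (*ₗ-comm p (q ++ r))
    (≋-trans (*ₗ-distribʳ p q r) (++-cong (*ₗ-comm q p) (*ₗ-comm r p)))

  polyRing : CommutativeRing c (c ⊔ ℓ)
  polyRing = record
    { Carrier = LP ; _≈_ = _≋_ ; _+_ = _++_ ; _*_ = _*ₗ_ ; -_ = -ₗ_ ; 0# = [] ; 1# = 1ₗ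
    ; isCommutativeRing = record
      { isRing = record
        { +-isAbelianGroup = record
          { isGroup = record
            { isMonoid = record
              { isSemigroup = record
                { isMagma = record
                  { isEquivalence = record
                    { refl = ≋-refl ; sym = ≋-sym ; trans = ≋-trans }
                  ; ∙-cong = ++-cong }
                ; assoc = λ p q r → ≋-reflexive (ListP.++-assoc p q r) }
              ; identity = (λ p → ≋-refl) , (λ p → ≋-reflexive (ListP.++-identityʳ p)) }
            ; inverse = -ₗ-inverseˡ
                , (λ p → ≋-trans (++-comm p (-ₗ p)) (-ₗ-inverseˡ p))
            ; ⁻¹-cong = -ₗ-cong }
          ; comm = ++-comm }
        ; *-cong = *ₗ-cong
        ; *-assoc = *ₗ-assoc
        ; *-identity = *ₗ-identityˡ , *ₗ-identityʳ
        ; distrib = *ₗ-distribˡ , *ₗ-distribʳ }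
      ; *-comm = *ₗ-comm } }

  module R = CommutativeRing polyRing

  -- Coefficients as functionals

  δ : Exp → Exp → Carrier
  δ e e′ = if does (e′ ≟ₑ e) then 1# else 0#

  δ-≡ : ∀ {e e′} → e′ ≡ e → δ e e′ ≈ 1#
  δ-≡ {e} {e′} eq rewrite dec-true (e′ ≟ₑ e) eq = K.refl

  δ-≢ : ∀ {e e′} → ¬ e′ ≡ e → δ e e′ ≈ 0#
  δ-≢ {e} {e′} neq rewrite dec-false (e′ ≟ₑ e) neq = K.refl

  δ-⇔ : ∀ {e e′ f f′} → (e′ ≡ e → f′ ≡ f) → (f′ ≡ f → e′ ≡ e) → δ e e′ ≈ δ f f′
  δ-⇔ {e} {e′} {f} {f′} to from with e′ ≟ₑ e
  ... | yes eq = K.sym (δ-≡ (to eq))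
  ... | no neq = K.sym (δ-≢ (λ eq → neq (from eq)))

  coeff-eval : ∀ p e → coeff p e ≈ eval p (δ e)
  coeff-eval []             e = K.refl
  coeff-eval ((a , e′) ∷ p) e with does (e′ ≟ₑ e)
  ... | true  = K.+-cong (K.sym (K.*-identityʳ a)) (coeff-eval p e)
  ... | false = K.trans (coeff-eval p e) (K.trans (K.sym (K.+-identityˡ _)) (K.+-congʳ (K.sym (K.zeroʳ a))))

  ≋⇒≈ₗ : ∀ {p q} → p ≋ q → p ≈ₗ q
  ≋⇒≈ₗ {p} {q} eq e = K.trans (coeff-eval p e) (K.trans (at eq (δ e)) (K.sym (coeff-eval q e)))

  without : Exp → LP → LP
  without e = L.filter (λ t → ¬? (proj₂ t ≟ₑ e))

  eval-without : ∀ p e φ → eval p φ ≈ coeff p e * φ e + eval (without e p) φ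
  eval-without []             e φ = K.sym (K.trans (K.+-identityʳ _) (K.zeroˡ _))
  eval-without ((a , e′) ∷ p) e φ with e′ ≟ₑ e
  ... | yes refl = begin
    a * φ e + eval p φ                                      ≈⟨ K.+-congˡ (eval-without p e φ) ⟩
    a * φ e + (coeff p e * φ e + eval (without e p) φ)      ≈⟨ K.sym (K.+-assoc _ _ _) ⟩
    (a * φ e + coeff p e * φ e) + eval (without e p) φ      ≈⟨ K.+-congʳ (K.sym (K.distribʳ _ _ _)) ⟩
    (a + coeff p e) * φ e + eval (without e p) φ            ∎
  ... | no _ = begin
    a * φ e′ + eval p φ                                     ≈⟨ K.+-congˡ (eval-without p e φ) ⟩
    a * φ e′ + (coeff p e * φ e + eval (without e p) φ)     ≈⟨ +-x∙yz≈y∙xz _ _ _ ⟩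
    coeff p e * φ e + (a * φ e′ + eval (without e p) φ)     ∎

  coeff-without-≢ : ∀ p {e e′} → ¬ e ≡ e′ → coeff (without e p) e′ ≈ coeff p e′
  coeff-without-≢ p {e} {e′} neq = K.sym (begin
    coeff p e′                                          ≈⟨ coeff-eval p e′ ⟩
    eval p (δ e′)                                       ≈⟨ eval-without p e (δ e′) ⟩
    coeff p e * δ e′ e + eval (without e p) (δ e′)      ≈⟨ K.+-congʳ (K.trans (K.*-congˡ (δ-≢ neq)) (K.zeroʳ _)) ⟩
    0# + eval (without e p) (δ e′)                      ≈⟨ K.+-identityˡ _ ⟩
    eval (without e p) (δ e′)                           ≈⟨ K.sym (coeff-eval (without e p) e′) ⟩
    coeff (without e p) e′                              ∎)

  coeff-absent : ∀ {p e} → All (λ t → ¬ proj₂ t ≡ e) p → coeff p e ≈ 0#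
  coeff-absent {p} {e} nes = K.trans (coeff-eval p e)
    (K.trans (eval-cong-All (All.map δ-≢ nes)) (eval-zero p))

  coeff-without-≡ : ∀ p e → coeff (without e p) e ≈ 0#
  coeff-without-≡ p e = coeff-absent {without e p} (AllP.all-filter (λ t → ¬? (proj₂ t ≟ₑ e)) p)

  length-without : ∀ a e p → L.length (without e ((a , e) ∷ p)) ℕ.≤ L.length p
  length-without a e p with e ≟ₑ e
  ... | yes _  = ListP.length-filter (λ t → ¬? (proj₂ t ≟ₑ e)) p
  ... | no neq = ⊥-elim (neq refl)

  -- Exponents may repeat, so single entries need not vanish. All terms that share the exponent of
  -- the head are split off together; they contribute a multiple of one coefficient, and the
  -- remaining list is shorter though not a structural tail, hence the induction on a length bound.
  coeff≈0⇒eval≈0 : ∀ p φ → (∀ e → coeff p e ≈ 0#) → eval p φ ≈ 0#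
  coeff≈0⇒eval≈0 p φ = go (L.length p) p ℕP.≤-refl
    where
    go : ∀ m p → L.length p ℕ.≤ m → (∀ e → coeff p e ≈ 0#) → eval p φ ≈ 0#
    go m       []                _           zs = K.refl
    go (suc m) q@((a , e) ∷ p) (ℕ.s≤s len) zs = begin
      eval q φ                                      ≈⟨ eval-without q e φ ⟩
      coeff q e * φ e + eval (without e q) φ        ≈⟨ K.+-cong (K.*-congʳ (zs e)) (go m (without e q) (ℕP.≤-trans (length-without a e p) len) zs′) ⟩
      0# * φ e + 0#                                 ≈⟨ K.trans (K.+-identityʳ _) (K.zeroˡ _) ⟩
      0#                                            ∎
      where
      zs′ : ∀ e′ → coeff (without e q) e′ ≈ 0#
      zs′ e′ with e ≟ₑ e′
      ... | yes refl = coeff-without-≡ q e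
      ... | no neq   = K.trans (coeff-without-≢ q neq) (zs e′)

  ≈ₗ⇒≋ : ∀ p q → p ≈ₗ q → p ≋ q
  ≈ₗ⇒≋ p q eq = extensional λ φ → x∙y⁻¹≈ε⇒x≈y _ _ (K.trans (K.sym (difference φ)) (coeff≈0⇒eval≈0 (p ++ (-ₗ q)) φ zs))
    where
    open import Algebra.Properties.Group K.+-group using (x∙y⁻¹≈ε⇒x≈y)
    difference : ∀ φ → eval (p ++ (-ₗ q)) φ ≈ eval p φ + K.- eval q φ
    difference φ = K.trans (eval-++ p (-ₗ q) φ) (K.+-congˡ (eval-neg q φ))
    zs : ∀ e → coeff (p ++ (-ₗ q)) e ≈ 0#
    zs e = begin
      coeff (p ++ (-ₗ q)) e             ≈⟨ coeff-eval (p ++ (-ₗ q)) e ⟩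
      eval (p ++ (-ₗ q)) (δ e)          ≈⟨ difference (δ e) ⟩
      eval p (δ e) + K.- eval q (δ e)   ≈⟨ K.sym (K.+-cong (coeff-eval p e) (K.-‿cong (coeff-eval q e))) ⟩
      coeff p e + K.- coeff q e         ≈⟨ K.+-congʳ (eq e) ⟩
      coeff q e + K.- coeff q e         ≈⟨ K.-‿inverseʳ _ ⟩
      0#                                ∎

-- Lexicographic order on integer vectors

infix 4 _≺_
_≺_ : ∀ {m} → Vec ℤ m → Vec ℤ m → Set
[]       ≺ []       = ⊥
(x ∷ xs) ≺ (y ∷ ys) = x ℤ.< y ⊎ (x ≡ y × xs ≺ ys)

≺-irrefl : ∀ {m} (xs : Vec ℤ m) → ¬ xs ≺ xs
≺-irrefl (x ∷ xs) (inj₁ x<x)        = ℤP.<-irrefl refl x<x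
≺-irrefl (x ∷ xs) (inj₂ (_ , lt)) = ≺-irrefl xs lt

≺-trans : ∀ {m} (xs ys zs : Vec ℤ m) → xs ≺ ys → ys ≺ zs → xs ≺ zs
≺-trans [] [] [] ()
≺-trans (x ∷ xs) (y ∷ ys) (z ∷ zs) (inj₁ lt)          (inj₁ lt′)         = inj₁ (ℤP.<-trans lt lt′)
≺-trans (x ∷ xs) (y ∷ ys) (z ∷ zs) (inj₁ lt)          (inj₂ (refl , _))  = inj₁ lt
≺-trans (x ∷ xs) (y ∷ ys) (z ∷ zs) (inj₂ (refl , _))  (inj₁ lt)          = inj₁ lt
≺-trans (x ∷ xs) (y ∷ ys) (z ∷ zs) (inj₂ (refl , lt)) (inj₂ (refl , lt′)) = inj₂ (refl , ≺-trans xs ys zs lt lt′)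

≺-compare : ∀ {m} (xs ys : Vec ℤ m) → xs ≺ ys ⊎ (xs ≡ ys ⊎ ys ≺ xs)
≺-compare []       []       = inj₂ (inj₁ refl)
≺-compare (x ∷ xs) (y ∷ ys) with ℤP.<-cmp x y
... | tri< lt _ _ = inj₁ (inj₁ lt)
... | tri> _ _ gt = inj₂ (inj₂ (inj₁ gt))
... | tri≈ _ refl _ with ≺-compare xs ys
...   | inj₁ lt          = inj₁ (inj₂ (refl , lt))
...   | inj₂ (inj₁ refl) = inj₂ (inj₁ refl)
...   | inj₂ (inj₂ gt)   = inj₂ (inj₂ (inj₂ (refl , gt)))

≺-monoʳ-+ : ∀ {m} (xs ys zs : Vec ℤ m) → ys ≺ zs → V.zipWith ℤ._+_ xs ys ≺ V.zipWith ℤ._+_ xs zs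
≺-monoʳ-+ [] [] [] ()
≺-monoʳ-+ (x ∷ xs) (y ∷ ys) (z ∷ zs) (inj₁ lt)          = inj₁ (ℤP.+-monoʳ-< x lt)
≺-monoʳ-+ (x ∷ xs) (y ∷ ys) (z ∷ zs) (inj₂ (refl , lt)) = inj₂ (refl , ≺-monoʳ-+ xs ys zs lt)

-- Homogenised equations of integral dependence

module IntegralRelations {a ℓ} (Q : CommutativeRing a ℓ) where
  open CommutativeRing Q using (Carrier; _≈_; _+_; _*_; +-cong; *-cong; *-congˡ; *-congʳ; *-comm; *-assoc; distribˡ; setoid)
    renaming (sym to ≈-sym; trans to ≈-trans; reflexive to ≈-reflexive)
  open import Algebra.Properties.CommutativeSemiring.Exp (CommutativeRing.commutativeSemiring Q)
  open import Algebra.Properties.Semiring.Sum (CommutativeRing.semiring Q) using (sum; sum-cong-≋; *-distribˡ-sum)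
  open import Algebra.Properties.CommutativeSemigroup (CommutativeRing.*-commutativeSemigroup Q)
    using (interchange; x∙yz≈y∙xz)

  term : ∀ d → (Fin d → Carrier) → Carrier → Carrier → Fin d → Carrier
  term d cs f g i = cs i * (f ^ toℕ i * g ^ (d ℕ.∸ toℕ i))

  -- Vanishes iff f/g is a root of X^d + Σ cᵢ Xⁱ (when g is regular).
  relation : ∀ d → (Fin d → Carrier) → Carrier → Carrier → Carrier
  relation d cs f g = f ^ d + sum (term d cs f g)

  relation-cong : ∀ d cs cs′ {f f′ g g′} → (∀ i → cs i ≈ cs′ i) → f ≈ f′ → g ≈ g′ →
                  relation d cs f g ≈ relation d cs′ f′ g′
  relation-cong d cs cs′ eqc eqf eqg = +-cong (^-congˡ d eqf)
    (sum-cong-≋ (λ i → *-cong (eqc i) (*-cong (^-congˡ (toℕ i) eqf) (^-congˡ (d ℕ.∸ toℕ i) eqg))))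

  relation-* : ∀ d cs cs′ f f′ g g′ z → f′ ^ d ≈ z * f ^ d →
               (∀ i → term d cs′ f′ g′ i ≈ z * term d cs f g i) →
               relation d cs′ f′ g′ ≈ z * relation d cs f g
  relation-* d cs cs′ f f′ g g′ z eq eqs = ≈-trans
    (+-cong eq (≈-trans (sum-cong-≋ eqs) (≈-sym (*-distribˡ-sum z (term d cs f g)))))
    (≈-sym (distribˡ z (f ^ d) (sum (term d cs f g))))

  ^-split : ∀ z d (i : Fin d) → z ^ toℕ i * z ^ (d ℕ.∸ toℕ i) ≈ z ^ d
  ^-split z d i = ≈-trans (≈-sym (^-homo-* z (toℕ i) (d ℕ.∸ toℕ i)))
    (≈-reflexive (cong (z ^_) (ℕP.m+[n∸m]≡n (ℕP.<⇒≤ (FinP.toℕ<n i)))))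

  -- The relation is a form of degree d in (f, g), so expanding the fraction f/g by z keeps it a
  -- root of the same polynomial.
  relation-homogeneous : ∀ d cs z f g → relation d cs (z * f) (z * g) ≈ z ^ d * relation d cs f g
  relation-homogeneous d cs z f g = relation-* d cs cs f _ g _ (z ^ d) (^-distrib-* z f d) λ i →
    let j = toℕ i ; r = d ℕ.∸ j in begin
    cs i * ((z * f) ^ j * (z * g) ^ r)              ≈⟨ *-congˡ (*-cong (^-distrib-* z f j) (^-distrib-* z g r)) ⟩
    cs i * ((z ^ j * f ^ j) * (z ^ r * g ^ r))      ≈⟨ *-congˡ (interchange _ _ _ _) ⟩
    cs i * ((z ^ j * z ^ r) * (f ^ j * g ^ r))      ≈⟨ x∙yz≈y∙xz _ _ _ ⟩
    (z ^ j * z ^ r) * (cs i * (f ^ j * g ^ r))      ≈⟨ *-congʳ (^-split z d i) ⟩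
    z ^ d * (cs i * (f ^ j * g ^ r))                ∎
    where open import Relation.Binary.Reasoning.Setoid setoid

  -- If α is a root of the monic polynomial with coefficients cᵢ, then z α is a root of the one with
  -- coefficients z^(d - i) cᵢ.
  twist : ∀ d → Carrier → (Fin d → Carrier) → Fin d → Carrier
  twist d z cs i = z ^ (d ℕ.∸ toℕ i) * cs i

  relation-twist : ∀ d cs z f g → relation d (twist d z cs) (z * f) g ≈ z ^ d * relation d cs f g
  relation-twist d cs z f g = relation-* d cs (twist d z cs) f _ g _ (z ^ d) (^-distrib-* z f d) λ i →
    let j = toℕ i ; r = d ℕ.∸ j in begin
    (z ^ r * cs i) * ((z * f) ^ j * g ^ r)          ≈⟨ *-congˡ (*-congʳ (^-distrib-* z f j)) ⟩
    (z ^ r * cs i) * ((z ^ j * f ^ j) * g ^ r)      ≈⟨ *-congˡ (*-assoc _ _ _) ⟩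
    (z ^ r * cs i) * (z ^ j * (f ^ j * g ^ r))      ≈⟨ interchange _ _ _ _ ⟩
    (z ^ r * z ^ j) * (cs i * (f ^ j * g ^ r))      ≈⟨ *-congʳ (≈-trans (*-comm _ _) (^-split z d i)) ⟩
    z ^ d * (cs i * (f ^ j * g ^ r))                ∎
    where open import Relation.Binary.Reasoning.Setoid setoid

-- Supports, lowest terms and the removal of light terms

module Relations {c ℓ} (K : Field c ℓ) (n : ℕ) where
  open Laurent K n
  open Polynomials K n
  open K using (Carrier; _≈_; _+_; _*_; 0#; 1#)
  open import Algebra.Properties.Semiring.Exp K.semiring using (_^_; ^-congˡ)
  open import Algebra.Properties.CommutativeSemigroup K.*-commutativeSemigroup using (x∙yz≈y∙xz)
  import Algebra.Properties.CommutativeSemiring.Exp R.commutativeSemiring as RE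
  import Relation.Binary.Reasoning.Setoid as SetoidReasoning

  open IntegralRelations polyRing
  open import Algebra.Properties.Semiring.Sum R.semiring using (sum; sum-cong-≋)

  ^ₗ≡^ : ∀ p k → p ^ₗ k ≡ p RE.^ k
  ^ₗ≡^ p zero    = refl
  ^ₗ≡^ p (suc k) = cong (p *ₗ_) (^ₗ≡^ p k)

  Σₗ≡sum : ∀ {m} (F : Fin m → LP) → Σₗ F ≡ sum F
  Σₗ≡sum {zero}  F = refl
  Σₗ≡sum {suc m} F = cong (F zero ++_) (Σₗ≡sum (λ i → F (suc i)))

  relationₗ≋relation : ∀ d cs f g →
    (f ^ₗ d) +ₗ Σₗ (λ i → cs i *ₗ ((f ^ₗ toℕ i) *ₗ (g ^ₗ (d ℕ.∸ toℕ i)))) ≋ relation d cs f g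
  relationₗ≋relation d cs f g = R.+-cong (≋-reflexive (^ₗ≡^ f d))
    (R.trans (≋-reflexive (Σₗ≡sum (λ i → cs i *ₗ ((f ^ₗ toℕ i) *ₗ (g ^ₗ (d ℕ.∸ toℕ i))))))
      (sum-cong-≋ λ i → ≋-reflexive (cong (cs i *ₗ_) (cong₂ _*ₗ_ (^ₗ≡^ f (toℕ i)) (^ₗ≡^ g (d ℕ.∸ toℕ i))))))

  Supp : ∀ {a} → (Exp → Set a) → LP → Set (c ⊔ a)
  Supp P p = All (λ t → P (proj₂ t)) p

  Supp-* : ∀ {a b d} {P : Exp → Set a} {Q : Exp → Set b} {S : Exp → Set d} {p q} →
           (∀ {e e′} → P e → Q e′ → S (e +ₑ e′)) → Supp P p → Supp Q q → Supp S (p *ₗ q)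
  Supp-* f []         Qq = []
  Supp-* f (Pe ∷ Pp) Qq = AllP.++⁺ (AllP.map⁺ (All.map (f Pe) Qq)) (Supp-* f Pp Qq)

  Supp-^ : ∀ {a b} {P : Exp → Set a} {S : ℕ → Exp → Set b} {p} → S 0 0ₑ →
           (∀ {k e e′} → P e → S k e′ → S (suc k) (e +ₑ e′)) → Supp P p → ∀ k → Supp (S k) (p RE.^ k)
  Supp-^         s₀ f Pp zero    = s₀ ∷ []
  Supp-^ {S = S} s₀ f Pp (suc k) = Supp-* {S = S (suc k)} f Pp (Supp-^ {S = S} s₀ f Pp k)

  Supp-Σ : ∀ {a} {P : Exp → Set a} {m} {F : Fin m → LP} → (∀ i → Supp P (F i)) → Supp P (sum F)
  Supp-Σ {m = zero}  h = []
  Supp-Σ {m = suc m} h = AllP.++⁺ (h zero) (Supp-Σ (λ i → h (suc i)))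

  coeff-++ : ∀ p q e → coeff (p ++ q) e ≈ coeff p e + coeff q e
  coeff-++ p q e = K.trans (coeff-eval (p ++ q) e)
    (K.trans (eval-++ p q (δ e)) (K.sym (K.+-cong (coeff-eval p e) (coeff-eval q e))))

  scale : Carrier → LP → LP
  scale x = L.map (λ t → x * proj₁ t , proj₂ t)

  eval-scale : ∀ x p φ → eval (scale x p) φ ≈ x * eval p φ
  eval-scale x []            φ = K.sym (K.zeroʳ x)
  eval-scale x ((a , e) ∷ p) φ =
    K.trans (K.+-cong (K.*-assoc x a _) (eval-scale x p φ)) (K.sym (K.distribˡ x _ _))

  coeff-scale : ∀ x p e → coeff (scale x p) e ≈ x * coeff p e
  coeff-scale x p e = K.trans (coeff-eval (scale x p) e)
    (K.trans (eval-scale x p (δ e)) (K.*-congˡ (K.sym (coeff-eval p e))))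

  monomial : Carrier → Exp → LP
  monomial a e = (a , e) ∷ []

  eval-monomial-* : ∀ a e p φ → eval (monomial a e *ₗ p) φ ≈ a * eval p (λ e′ → φ (e +ₑ e′))
  eval-monomial-* a e p φ = K.trans (eval-*ₗ (monomial a e) p φ) (K.+-identityʳ _)

  scale≋ : ∀ x p → scale x p ≋ monomial x 0ₑ *ₗ p
  scale≋ x p = extensional λ φ → K.trans (eval-scale x p φ) (K.sym (K.trans (eval-monomial-* x 0ₑ p φ)
    (K.*-congˡ (eval-cong p (λ e → K.reflexive (cong φ (+ₑ-identityˡ e)))))))

  annihilate : ∀ x p → (∀ e → x * coeff p e ≈ 0#) → ∀ φ → x * eval p φ ≈ 0#
  annihilate x p zs φ = K.trans (K.sym (eval-scale x p φ))
    (coeff≈0⇒eval≈0 (scale x p) φ (λ e → K.trans (coeff-scale x p e) (zs e)))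

  without-* : ∀ h g u → (∀ e → coeff h u * coeff g e ≈ 0#) → h *ₗ g ≋ without u h *ₗ g
  without-* h g u zs = extensional λ φ → begin
    eval (h *ₗ g) φ
      ≈⟨ eval-*ₗ h g φ ⟩
    eval h (λ e → eval g (λ e′ → φ (e +ₑ e′)))
      ≈⟨ eval-without h u _ ⟩
    coeff h u * eval g (λ e′ → φ (u +ₑ e′)) + eval (without u h) (λ e → eval g (λ e′ → φ (e +ₑ e′)))
      ≈⟨ K.+-cong (annihilate (coeff h u) g zs _) (K.sym (eval-*ₗ (without u h) g φ)) ⟩
    0# + eval (without u h *ₗ g) φ
      ≈⟨ K.+-identityˡ _ ⟩
    eval (without u h *ₗ g) φ ∎
    where open SetoidReasoning K.setoid

  scale-without : ∀ x g e → x * coeff g e ≈ 0# → scale x (without e g) ≋ scale x g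
  scale-without x g e z = extensional λ φ → K.sym (begin
    eval (scale x g) φ                                      ≈⟨ eval-scale x g φ ⟩
    x * eval g φ                                            ≈⟨ K.*-congˡ (eval-without g e φ) ⟩
    x * (coeff g e * φ e + eval (without e g) φ)            ≈⟨ K.distribˡ x _ _ ⟩
    x * (coeff g e * φ e) + x * eval (without e g) φ        ≈⟨ K.+-congʳ (K.trans (K.sym (K.*-assoc _ _ _)) (K.trans (K.*-congʳ z) (K.zeroˡ _))) ⟩
    0# + x * eval (without e g) φ                           ≈⟨ K.+-identityˡ _ ⟩
    x * eval (without e g) φ                                ≈⟨ K.sym (eval-scale x (without e g) φ) ⟩
    eval (scale x (without e g)) φ                          ∎)
    where open SetoidReasoning K.setoid

  -- A property to be established even for a field: `inverse` applies only to elements known to be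
  -- nonzero, so from x * x ≈ 0# it yields merely the double negation of x ≈ 0#.
  Reduced : Set (c ⊔ ℓ)
  Reduced = ∀ x → x * x ≈ 0# → x ≈ 0#

  nilpotent⇒0 : Reduced → ∀ x k → x ^ suc k ≈ 0# → x ≈ 0#
  nilpotent⇒0 reduced x zero    eq = K.trans (K.sym (K.*-identityʳ x)) eq
  nilpotent⇒0 reduced x (suc k) eq = nilpotent⇒0 reduced x k (reduced (x ^ suc k) (begin
    (x * x ^ k) * x ^ suc k   ≈⟨ K.*-congʳ (K.*-comm x (x ^ k)) ⟩
    (x ^ k * x) * x ^ suc k   ≈⟨ K.*-assoc _ _ _ ⟩
    x ^ k * (x * x ^ suc k)   ≈⟨ K.*-congˡ eq ⟩
    x ^ k * 0#                ≈⟨ K.zeroʳ _ ⟩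
    0#                        ∎))
    where open SetoidReasoning K.setoid

  infixr 8 _×ₑ_
  _×ₑ_ : ℕ → Exp → Exp
  zero  ×ₑ e = 0ₑ
  suc k ×ₑ e = e +ₑ (k ×ₑ e)

  record Weight : Set where
    field
      weight   : Exp → ℤ
      weight-+ : ∀ e e′ → weight (e +ₑ e′) ≡ weight e ℤ.+ weight e′

    weight-0 : weight 0ₑ ≡ ℤ.0ℤ
    weight-0 = identityʳ-unique (weight 0ₑ) (weight 0ₑ)
      (trans (sym (weight-+ 0ₑ 0ₑ)) (cong weight (+ₑ-identityˡ 0ₑ)))
      where open import Algebra.Properties.Group (AbelianGroup.group ℤP.+-0-abelianGroup) using (identityʳ-unique)

    weight-× : ∀ k e → weight (k ×ₑ e) ≡ + k ℤ.* weight e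
    weight-× zero    e = trans weight-0 (sym (ℤP.*-zeroˡ (weight e)))
    weight-× (suc k) e = trans (weight-+ e (k ×ₑ e)) (trans (cong (λ z → weight e ℤ.+ z) (weight-× k e))
      (sym (ℤP.suc-* (+ k) (weight e))))

  -- The monomials are ordered by a given weight, ties being broken lexicographically;
  -- the smallest monomial of a product is then the product of the smallest monomials.
  module MonomialOrder (W : Weight) where
    open Weight W

    key : Exp → Vec ℤ (2 ℕ.+ n)
    key (a , k) = weight (a , k) ∷ + k ∷ a

    key-injective : ∀ {e e′} → key e ≡ key e′ → e ≡ e′
    key-injective {a , k} {b , l} eq =
      cong₂ _,_ (VP.∷-injectiveʳ (VP.∷-injectiveʳ eq)) (ℤP.+-injective (VP.∷-injectiveˡ (VP.∷-injectiveʳ eq)))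

    key-+ : ∀ e e′ → key (e +ₑ e′) ≡ V.zipWith ℤ._+_ (key e) (key e′)
    key-+ e@(a , k) e′@(b , l) = cong₂ _∷_ (weight-+ e e′) refl

    infix 4 _≼_
    _≼_ : Exp → Exp → Set
    u ≼ e = e ≡ u ⊎ key u ≺ key e

    ≼-refl : ∀ {e} → e ≼ e
    ≼-refl = inj₁ refl

    ≼-trans : ∀ {u v e} → u ≼ v → v ≼ e → u ≼ e
    ≼-trans (inj₁ refl) v≼e         = v≼e
    ≼-trans (inj₂ lt)   (inj₁ refl) = inj₂ lt
    ≼-trans {u} {v} {e} (inj₂ lt) (inj₂ lt′) = inj₂ (≺-trans (key u) (key v) (key e) lt lt′)

    ≼-total : ∀ u v → u ≼ v ⊎ v ≼ u
    ≼-total u v with ≺-compare (key u) (key v)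
    ... | inj₁ lt        = inj₁ (inj₂ lt)
    ... | inj₂ (inj₁ eq) = inj₁ (inj₁ (key-injective (sym eq)))
    ... | inj₂ (inj₂ gt) = inj₂ (inj₂ gt)

    weight-mono : ∀ {u e} → u ≼ e → weight u ℤ.≤ weight e
    weight-mono (inj₁ refl)            = ℤP.≤-refl
    weight-mono (inj₂ (inj₁ lt))       = ℤP.<⇒≤ lt
    weight-mono (inj₂ (inj₂ (eq , _))) = ℤP.≤-reflexive eq

    ≺-monoʳ : ∀ u {v e} → key v ≺ key e → key (u +ₑ v) ≺ key (u +ₑ e)
    ≺-monoʳ u {v} {e} lt = ≡.subst₂ _≺_ (sym (key-+ u v)) (sym (key-+ u e)) (≺-monoʳ-+ (key u) (key v) (key e) lt)

    ≼-monoʳ : ∀ u {v e} → v ≼ e → u +ₑ v ≼ u +ₑ e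
    ≼-monoʳ u (inj₁ refl) = inj₁ refl
    ≼-monoʳ u (inj₂ lt)   = inj₂ (≺-monoʳ u lt)

    ≼-monoˡ : ∀ u {v e} → v ≼ e → v +ₑ u ≼ e +ₑ u
    ≼-monoˡ u {v} {e} le = ≡.subst₂ _≼_ (+ₑ-comm u v) (+ₑ-comm u e) (≼-monoʳ u le)

    ≼-+ : ∀ {u v e f} → u ≼ e → v ≼ f → u +ₑ v ≼ e +ₑ f
    ≼-+ {u} {v} {e} {f} le le′ = ≼-trans (≼-monoˡ v le) (≼-monoʳ e le′)

    -- If u were strictly below e, then u + v would be strictly below e + v and hence below e + f.
    -- So only one pair of exponents contributes to the lowest monomial of a product.
    ≼-+-tight : ∀ {u v e f} → u ≼ e → v ≼ f → e +ₑ f ≡ u +ₑ v → e ≡ u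
    ≼-+-tight             (inj₁ eq) le′ eq′ = eq
    ≼-+-tight {u} {v} {e} {f} (inj₂ lt) le′ eq′ = ⊥-elim (irrefl (≼-monoʳ e le′))
      where
      lt′ : key (e +ₑ f) ≺ key (e +ₑ v)
      lt′ = ≡.subst₂ (λ x y → key x ≺ key y) (trans (+ₑ-comm v u) (sym eq′)) (+ₑ-comm v e) (≺-monoʳ v lt)
      irrefl : ¬ e +ₑ v ≼ e +ₑ f
      irrefl (inj₁ eq) = ≺-irrefl (key (e +ₑ v)) (subst (λ z → key z ≺ key (e +ₑ v)) eq lt′)
      irrefl (inj₂ lt″) = ≺-irrefl (key (e +ₑ f)) (≺-trans (key (e +ₑ f)) (key (e +ₑ v)) (key (e +ₑ f)) lt′ lt″)

    minimum : ∀ t p → Σ Exp λ u → Any (λ s → proj₂ s ≡ u) (t ∷ p) × Supp (u ≼_) (t ∷ p)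
    minimum (a , e) []      = e , here refl , ≼-refl ∷ []
    minimum (a , e) (t ∷ p) with minimum t p
    ... | u , u∈p , u≼p with ≼-total u e
    ...   | inj₁ u≼e = u , there u∈p , u≼e ∷ u≼p
    ...   | inj₂ e≼u = e , here refl , ≼-refl ∷ All.map (≼-trans e≼u) u≼p

    -- On the exponents that occur, the indicator of u + v factors into those of u and v. Both are
    -- mere lower bounds of the supports; their coefficients may well be zero, which could not be
    -- tested.
    coeff-lead-* : ∀ {p q u v} → Supp (u ≼_) p → Supp (v ≼_) q → coeff (p *ₗ q) (u +ₑ v) ≈ coeff p u * coeff q v
    coeff-lead-* {p} {q} {u} {v} u≼p v≼q = begin
      coeff (p *ₗ q) (u +ₑ v)
        ≈⟨ coeff-eval (p *ₗ q) (u +ₑ v) ⟩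
      eval (p *ₗ q) (δ (u +ₑ v))
        ≈⟨ eval-*ₗ p q (δ (u +ₑ v)) ⟩
      eval p (λ e → eval q (λ e′ → δ (u +ₑ v) (e +ₑ e′)))
        ≈⟨ eval-cong-All (All.map (λ u≼e → eval-cong-All (All.map (λ v≼e′ → δ-lead u≼e v≼e′) v≼q)) u≼p) ⟩
      eval p (λ e → eval q (λ e′ → δ u e * δ v e′))
        ≈⟨ eval-cong p (λ e → K.trans (eval-* q (δ u e) (δ v)) (K.*-comm _ _)) ⟩
      eval p (λ e → eval q (δ v) * δ u e)
        ≈⟨ eval-* p (eval q (δ v)) (δ u) ⟩
      eval q (δ v) * eval p (δ u)
        ≈⟨ K.*-comm _ _ ⟩
      eval p (δ u) * eval q (δ v)
        ≈⟨ K.sym (K.*-cong (coeff-eval p u) (coeff-eval q v)) ⟩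
      coeff p u * coeff q v ∎
      where
      open SetoidReasoning K.setoid
      δ-lead : ∀ {e e′} → u ≼ e → v ≼ e′ → δ (u +ₑ v) (e +ₑ e′) ≈ δ u e * δ v e′
      δ-lead {e} {e′} u≼e v≼e′ with e ≟ₑ u
      ... | yes refl = K.trans (δ-⇔ (+ₑ-cancelˡ e) (cong (e +ₑ_))) (K.sym (K.*-identityˡ _))
      ... | no  e≢u  = K.trans (δ-≢ (λ eq → e≢u (≼-+-tight u≼e v≼e′ eq))) (K.sym (K.zeroˡ _))

    ≼-^ : ∀ {p u} → Supp (u ≼_) p → ∀ k → Supp (k ×ₑ u ≼_) (p RE.^ k)
    ≼-^ {u = u} = Supp-^ {S = λ k → k ×ₑ u ≼_} ≼-refl ≼-+

    coeff-lead-^ : ∀ {p u} → Supp (u ≼_) p → ∀ k → coeff (p RE.^ k) (k ×ₑ u) ≈ coeff p u ^ k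
    coeff-lead-^ u≼p zero    = K.trans (coeff-eval 1ₗ 0ₑ)
      (K.trans (K.+-identityʳ _) (K.trans (K.*-identityˡ _) (δ-≡ {0ₑ} refl)))
    coeff-lead-^ u≼p (suc k) = K.trans (coeff-lead-* u≼p (≼-^ u≼p k)) (K.*-congˡ (coeff-lead-^ u≼p k))

    Heavy : ℤ → LP → Set c
    Heavy w = Supp (λ e → w ℤ.≤ weight e)

    Heavy-* : ∀ {v w p q} → Heavy v p → Heavy w q → Heavy (v ℤ.+ w) (p *ₗ q)
    Heavy-* {v} {w} = Supp-* λ {e} {e′} le le′ →
      subst (v ℤ.+ w ℤ.≤_) (sym (weight-+ e e′)) (ℤP.+-mono-≤ le le′)

    Heavy-^ : ∀ {w p} → Heavy w p → ∀ k → Heavy (+ k ℤ.* w) (p RE.^ k)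
    Heavy-^ {w} = Supp-^ {S = λ k e → + k ℤ.* w ℤ.≤ weight e}
      (ℤP.≤-reflexive (trans (ℤP.*-zeroˡ w) (sym weight-0)))
      λ {k} {e} {e′} le le′ → ≡.subst₂ ℤ._≤_ (sym (ℤP.suc-* (+ k) w)) (sym (weight-+ e e′)) (ℤP.+-mono-≤ le le′)

    -- Only (h g)^d reaches the monomial d (u + v), every other summand being heavier.
    coeff-lead-relation : ∀ d cs θ {h g u v} → Supp (u ≼_) h → Supp (v ≼_) g → weight u ℤ.< θ →
      (∀ i → Heavy (+ (d ℕ.∸ toℕ i) ℤ.* θ) (cs i)) →
      coeff (relation d cs (h *ₗ g) g) (d ×ₑ (u +ₑ v)) ≈ (coeff h u * coeff g v) ^ d
    coeff-lead-relation d cs θ {h} {g} {u} {v} u≼h v≼g u<θ heavy = begin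
      coeff (relation d cs (h *ₗ g) g) e
        ≈⟨ coeff-++ ((h *ₗ g) RE.^ d) (sum (term d cs (h *ₗ g) g)) e ⟩
      coeff ((h *ₗ g) RE.^ d) e + coeff (sum (term d cs (h *ₗ g) g)) e
        ≈⟨ K.+-cong (coeff-lead-^ (Supp-* ≼-+ u≼h v≼g) d) (coeff-absent rest) ⟩
      coeff (h *ₗ g) (u +ₑ v) ^ d + 0#
        ≈⟨ K.+-identityʳ _ ⟩
      coeff (h *ₗ g) (u +ₑ v) ^ d
        ≈⟨ ^-congˡ d (coeff-lead-* u≼h v≼g) ⟩
      (coeff h u * coeff g v) ^ d ∎
      where
      open SetoidReasoning K.setoid
      e = d ×ₑ (u +ₑ v)
      α = weight u
      β = weight v
      -- Put r = d - i > 0. The i-th summand weighs at least r θ + i (α + β) + r β, and this exceeds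
      -- d (α + β) because α < θ.
      lighter : ∀ i r → (+ i ℤ.+ + suc r) ℤ.* (α ℤ.+ β) ℤ.<
                + suc r ℤ.* θ ℤ.+ (+ i ℤ.* (α ℤ.+ β) ℤ.+ + suc r ℤ.* β)
      lighter i r = subst (λ t → t ℤ.< + suc r ℤ.* θ ℤ.+ (+ i ℤ.* (α ℤ.+ β) ℤ.+ + suc r ℤ.* β)) (expand (+ i) (+ suc r) α β)
        (ℤP.+-monoˡ-< (+ i ℤ.* (α ℤ.+ β) ℤ.+ + suc r ℤ.* β) (ℤP.*-monoˡ-<-pos (+ suc r) u<θ))
        where
        expand : ∀ i r α β → r ℤ.* α ℤ.+ (i ℤ.* (α ℤ.+ β) ℤ.+ r ℤ.* β) ≡ (i ℤ.+ r) ℤ.* (α ℤ.+ β)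
        expand = solve-∀
      lighter′ : ∀ i r → i ℕ.+ r ≡ d → r ℕ.> 0 → weight e ℤ.<
                 + r ℤ.* θ ℤ.+ (+ i ℤ.* (α ℤ.+ β) ℤ.+ + r ℤ.* β)
      lighter′ i (suc r) refl _ = subst (λ t → t ℤ.< + suc r ℤ.* θ ℤ.+ (+ i ℤ.* (α ℤ.+ β) ℤ.+ + suc r ℤ.* β))
        (trans (cong (λ z → z ℤ.* (α ℤ.+ β)) (sym (ℤP.pos-+ i (suc r))))
          (sym (trans (weight-× d (u +ₑ v)) (cong (+ d ℤ.*_) (weight-+ u v)))))
        (lighter i r)
      rest : Supp (λ e′ → ¬ e′ ≡ e) (sum (term d cs (h *ₗ g) g))
      rest = Supp-Σ λ i → All.map
        (λ le → λ { refl → ℤP.<⇒≱ (lighter′ (toℕ i) (d ℕ.∸ toℕ i) (ℕP.m+[n∸m]≡n (ℕP.<⇒≤ (FinP.toℕ<n i)))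
                             (ℕP.m<n⇒0<n∸m (FinP.toℕ<n i))) le })
        (Heavy-* (heavy i) (Heavy-* (Heavy-^ (Heavy-* (All.map weight-mono u≼h) (All.map weight-mono v≼g)) (toℕ i))
                                    (Heavy-^ (All.map weight-mono v≼g) (d ℕ.∸ toℕ i))))

    -- `heavy` is the Newton polygon condition: the coefficients weigh at least as much as those of
    -- a monic polynomial all of whose roots have weight at least θ.
    module Light (reduced : Reduced) (d : ℕ) (cs : Fin (suc d) → LP) (θ : ℤ)
                 (heavy : ∀ i → Heavy (+ (suc d ℕ.∸ toℕ i) ℤ.* θ) (cs i)) where

      -- Classically one would argue modulo each prime of K.  Here x = coeff h u annihilates the
      -- lowest coefficient of g, and x g, without that term, replaces g.
      lightest-annihilates : ∀ {h u} → Supp (u ≼_) h → weight u ℤ.< θ → ∀ g →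
        relation (suc d) cs (h *ₗ g) g ≋ [] → ∀ e → coeff h u * coeff g e ≈ 0#
      lightest-annihilates {h} {u} u≼h u<θ g = go (L.length g) g ℕP.≤-refl
        where
        x = coeff h u
        go : ∀ m g → L.length g ℕ.≤ m → relation (suc d) cs (h *ₗ g) g ≋ [] → ∀ e → x * coeff g e ≈ 0#
        go m       []      _   eq e = K.zeroʳ x
        go (suc m) g@(t ∷ p) len eq e with minimum t p
        ... | v , v∈g , v≼g = conclude (v ≟ₑ e)
          where
          -- The lowest coefficient of the vanishing relation is the (d + 1)-st power of this
          -- product.
          lead : x * coeff g v ≈ 0#
          lead = nilpotent⇒0 reduced (x * coeff g v) d (K.trans
            (K.sym (coeff-lead-relation (suc d) cs θ u≼h v≼g u<θ heavy))
            (≋⇒≈ₗ eq (suc d ×ₑ (u +ₑ v))))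
          g′ = scale x (without v g)
          z  = monomial x 0ₑ
          len′ : L.length g′ ℕ.≤ m
          len′ = subst (ℕ._≤ m) (sym (ListP.length-map _ (without v g)))
            (ℕ.s≤s⁻¹ (ℕP.≤-trans (ListP.filter-notAll (λ s → ¬? (proj₂ s ≟ₑ v)) g (Any.map (λ eq ne → ne eq) v∈g)) len))
          g′≋ : g′ ≋ z *ₗ g
          g′≋ = R.trans (scale-without x g v lead) (scale≋ x g)
          eq′ : relation (suc d) cs (h *ₗ g′) g′ ≋ []
          eq′ = begin
            relation (suc d) cs (h *ₗ g′) g′
              ≈⟨ relation-cong (suc d) cs cs (λ i → R.refl) (R.trans (*ₗ-cong (R.refl {h}) g′≋) (RS.x∙yz≈y∙xz h z g)) g′≋ ⟩
            relation (suc d) cs (z *ₗ (h *ₗ g)) (z *ₗ g)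
              ≈⟨ relation-homogeneous (suc d) cs z (h *ₗ g) g ⟩
            (z RE.^ suc d) *ₗ relation (suc d) cs (h *ₗ g) g
              ≈⟨ *ₗ-cong (R.refl {z RE.^ suc d}) eq ⟩
            (z RE.^ suc d) *ₗ []
              ≈⟨ R.zeroʳ (z RE.^ suc d) ⟩
            [] ∎
            where
            open SetoidReasoning R.setoid
            import Algebra.Properties.CommutativeSemigroup R.*-commutativeSemigroup as RS
          conclude : Dec (v ≡ e) → x * coeff g e ≈ 0#
          conclude (yes refl) = lead
          -- The induction hypothesis concerns x g and so carries a second factor x; it makes the
          -- square of x * coeff g e vanish.
          conclude (no v≢e)   = reduced _ (begin
            (x * coeff g e) * (x * coeff g e)               ≈⟨ x∙yz≈y∙xz _ _ _ ⟩
            x * ((x * coeff g e) * coeff g e)               ≈⟨ K.*-congˡ (K.*-comm _ _) ⟩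
            x * (coeff g e * (x * coeff g e))               ≈⟨ x∙yz≈y∙xz _ _ _ ⟩
            coeff g e * (x * (x * coeff g e))               ≈⟨ K.*-congˡ (K.*-congˡ (K.*-congˡ (K.sym (coeff-without-≢ g v≢e)))) ⟩
            coeff g e * (x * (x * coeff (without v g) e))   ≈⟨ K.*-congˡ (K.*-congˡ (K.sym (coeff-scale x (without v g) e))) ⟩
            coeff g e * (x * coeff g′ e)                    ≈⟨ K.*-congˡ (go m g′ len′ eq′ e) ⟩
            coeff g e * 0#                                  ≈⟨ K.zeroʳ _ ⟩
            0#                                              ∎)
            where open SetoidReasoning K.setoid

      heavy? : Decidable (λ (t : Carrier × Exp) → θ ℤ.≤ weight (proj₂ t))
      heavy? t = θ ℤ.≤? weight (proj₂ t)

      -- The relation controls only the lowest exponent of h. While that one is light, its terms are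
      -- dropped, which changes neither h g nor the relation; once it is heavy, so are all the
      -- others.
      discard-light : ∀ g h → relation (suc d) cs (h *ₗ g) g ≋ [] → h *ₗ g ≋ L.filter heavy? h *ₗ g
      discard-light g h = go (L.length h) h ℕP.≤-refl
        where
        go : ∀ m h → L.length h ℕ.≤ m → relation (suc d) cs (h *ₗ g) g ≋ [] → h *ₗ g ≋ L.filter heavy? h *ₗ g
        go m       []      _   eq = R.refl
        go (suc m) h@(t ∷ p) len eq with minimum t p
        ... | u , u∈h , u≼h with θ ℤ.≤? weight u
        ...   | yes θ≤u = ≋-reflexive (cong (_*ₗ g) (sym (ListP.filter-all heavy? (All.map (λ u≼e → ℤP.≤-trans θ≤u (weight-mono u≼e)) u≼h))))
        ...   | no  θ≰u = R.trans drop (R.trans (go m h′ len′ (R.trans (relation-cong (suc d) cs cs (λ i → R.refl) (R.sym drop) (R.refl {g})) eq))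
                            (≋-reflexive (cong (_*ₗ g) (filter-without h))))
          where
          h′ = without u h
          drop : h *ₗ g ≋ h′ *ₗ g
          drop = without-* h g u (lightest-annihilates u≼h (ℤP.≰⇒> θ≰u) g eq)
          len′ : L.length h′ ℕ.≤ m
          len′ = ℕ.s≤s⁻¹ (ℕP.≤-trans (ListP.filter-notAll (λ s → ¬? (proj₂ s ≟ₑ u)) h (Any.map (λ eq ne → ne eq) u∈h)) len)
          filter-without : ∀ q → L.filter heavy? (without u q) ≡ L.filter heavy? q
          filter-without []            = refl
          filter-without ((a , e) ∷ q) with e ≟ₑ u
          ... | yes refl = trans (filter-without q) (sym (ListP.filter-reject heavy? θ≰u))
          ... | no _ with heavy? (a , e)
          ...   | yes _ = cong ((a , e) ∷_) (filter-without q)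
          ...   | no  _ = filter-without q

-- Integer vectors and Farkas' lemma

infixl 6 _⊕_
_⊕_ : ∀ {m} → Vec ℤ m → Vec ℤ m → Vec ℤ m
_⊕_ = V.zipWith ℤ._+_

infixr 7 _⊛_
_⊛_ : ∀ {m} → ℤ → Vec ℤ m → Vec ℤ m
x ⊛ a = V.map (x ℤ.*_) a

0ℤᵥ : ∀ {m} → Vec ℤ m
0ℤᵥ = V.replicate _ ℤ.0ℤ

⊛-⊕ˡ : ∀ {m} x y (a : Vec ℤ m) → (x ℤ.+ y) ⊛ a ≡ x ⊛ a ⊕ y ⊛ a
⊛-⊕ˡ x y []      = refl
⊛-⊕ˡ x y (z ∷ a) = cong₂ _∷_ (ℤP.*-distribʳ-+ z x y) (⊛-⊕ˡ x y a)

0-⊛ : ∀ {m} (a : Vec ℤ m) → ℤ.0ℤ ⊛ a ≡ 0ℤᵥ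
0-⊛ []      = refl
0-⊛ (z ∷ a) = cong₂ _∷_ (ℤP.*-zeroˡ z) (0-⊛ a)

1-⊛ : ∀ {m} (a : Vec ℤ m) → ℤ.1ℤ ⊛ a ≡ a
1-⊛ []      = refl
1-⊛ (z ∷ a) = cong₂ _∷_ (ℤP.*-identityˡ z) (1-⊛ a)

infix 7 _∙_
_∙_ : ∀ {m} → Vec ℤ m → Vec ℤ m → ℤ
[]      ∙ []      = ℤ.0ℤ
(x ∷ a) ∙ (y ∷ b) = x ℤ.* y ℤ.+ a ∙ b

∙-comm : ∀ {m} (a b : Vec ℤ m) → a ∙ b ≡ b ∙ a
∙-comm []      []      = refl
∙-comm (x ∷ a) (y ∷ b) = cong₂ ℤ._+_ (ℤP.*-comm x y) (∙-comm a b)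

∙-linear : ∀ {m} (l : Vec ℤ m) x a y b → l ∙ (x ⊛ a ⊕ y ⊛ b) ≡ x ℤ.* (l ∙ a) ℤ.+ y ℤ.* (l ∙ b)
∙-linear []      x []      y []      = sym (cong₂ ℤ._+_ (ℤP.*-zeroʳ x) (ℤP.*-zeroʳ y))
∙-linear (l ∷ ls) x (a ∷ as) y (b ∷ bs) rewrite ∙-linear ls x as y bs = rearrange l x a y b (ls ∙ as) (ls ∙ bs)
  where
  rearrange : ∀ l x a y b p q → l ℤ.* (x ℤ.* a ℤ.+ y ℤ.* b) ℤ.+ (x ℤ.* p ℤ.+ y ℤ.* q)
              ≡ x ℤ.* (l ℤ.* a ℤ.+ p) ℤ.+ y ℤ.* (l ℤ.* b ℤ.+ q)
  rearrange = solve-∀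

∙-⊕ : ∀ {m} (l a b : Vec ℤ m) → l ∙ (a ⊕ b) ≡ l ∙ a ℤ.+ l ∙ b
∙-⊕ l a b = trans (cong (l ∙_) (sym (cong₂ _⊕_ (1-⊛ a) (1-⊛ b))))
  (trans (∙-linear l ℤ.1ℤ a ℤ.1ℤ b) (cong₂ ℤ._+_ (ℤP.*-identityˡ (l ∙ a)) (ℤP.*-identityˡ (l ∙ b))))

∙-zeroˡ : ∀ {m} (u : Vec ℤ m) → 0ℤᵥ ∙ u ≡ ℤ.0ℤ
∙-zeroˡ []      = refl
∙-zeroˡ (x ∷ u) = trans (cong (ℤ._+ 0ℤᵥ ∙ u) (ℤP.*-zeroˡ x)) (trans (ℤP.+-identityˡ _) (∙-zeroˡ u))

-- The case of Farkas' lemma without generators, whose cone is {0}.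
nonzero⇒negative : ∀ {m} (u : Vec ℤ m) → u ≡ 0ℤᵥ ⊎ ∃ λ l → l ∙ u ℤ.< ℤ.0ℤ
nonzero⇒negative []      = inj₁ refl
nonzero⇒negative (x ∷ u) with ℤP.<-cmp x ℤ.0ℤ
... | tri< neg _ _  = inj₂ (ℤ.1ℤ ∷ 0ℤᵥ , subst (ℤ._< ℤ.0ℤ)
      (sym (trans (cong₂ ℤ._+_ (ℤP.*-identityˡ x) (∙-zeroˡ u)) (ℤP.+-identityʳ x))) neg)
... | tri> _ _ pos  = inj₂ (ℤ.-1ℤ ∷ 0ℤᵥ , subst (ℤ._< ℤ.0ℤ)
      (sym (trans (cong₂ ℤ._+_ (ℤP.-1*i≡-i x) (∙-zeroˡ u)) (ℤP.+-identityʳ _))) (ℤP.neg-mono-< pos))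
... | tri≈ _ refl _ = Sum.map (cong (ℤ.0ℤ ∷_))
      (λ { (l , neg) → ℤ.0ℤ ∷ l , subst (ℤ._< ℤ.0ℤ) (sym (ℤP.+-identityˡ (l ∙ u))) neg })
      (nonzero⇒negative u)

-- Farkas' lemma, by induction on the number of generators: if a functional l separates u
-- from V 1, V 2, … but is negative on V 0, project everything along V 0 onto the
-- hyperplane l = 0 (scaled by - l (V 0) to stay integral) and recurse.
module _ {N} (S : Vec ℤ N → Set) (S-0 : S 0ℤᵥ) (S-⊕ : ∀ {a b} → S a → S b → S (a ⊕ b)) where

  S-⊛ : ∀ k {a} → S a → S (+ k ⊛ a)
  S-⊛ zero    {a} Sa = subst S (sym (0-⊛ a)) S-0
  S-⊛ (suc k) {a} Sa = subst S (sym (trans (⊛-⊕ˡ ℤ.1ℤ (+ k) a) (cong (_⊕ + k ⊛ a) (1-⊛ a)))) (S-⊕ Sa (S-⊛ k Sa))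

  S-⊛-nonneg : ∀ {x a} → ℤ.0ℤ ℤ.≤ x → S a → S (x ⊛ a)
  S-⊛-nonneg {+ k} _ Sa = S-⊛ k Sa

  farkas : ∀ m (V : Fin m → Vec ℤ N) → (∀ j → S (V j)) → ∀ u →
           (∃ λ k → S (+ suc k ⊛ u)) ⊎ (∃ λ l → (∀ j → ℤ.0ℤ ℤ.≤ l ∙ V j) × l ∙ u ℤ.< ℤ.0ℤ)
  farkas zero V SV u with nonzero⇒negative u
  ... | inj₁ refl      = inj₁ (0 , subst S (sym (1-⊛ 0ℤᵥ)) S-0)
  ... | inj₂ (l , neg) = inj₂ (l , (λ ()) , neg)
  farkas (suc m) V SV u with farkas m (V ∘ suc) (SV ∘ suc) u
  ... | inj₁ combination   = inj₁ combination
  ... | inj₂ (l , l≥0 , l<0) with l ∙ V zero in l∙v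
  ...   | + k      = inj₂ (l , (λ { zero → subst (ℤ.0ℤ ℤ.≤_) (sym l∙v) (ℤ.+≤+ ℕ.z≤n) ; (suc j) → l≥0 j }) , l<0)
  ...   | -[1+ k ] = Sum.map lift combine (farkas m (λ j → project (V (suc j)))
                       (λ j → S-⊕ (S-⊛ (suc k) (SV (suc j))) (S-⊛-nonneg (l≥0 j) (SV zero))) (project u))
    where
    v = V zero
    project : Vec ℤ N → Vec ℤ N
    project w = + suc k ⊛ w ⊕ (l ∙ w) ⊛ v

    lift : (∃ λ i → S (+ suc i ⊛ project u)) → ∃ λ i → S (+ suc i ⊛ u)
    -- Since l ∙ u < 0, the v-component of `project u` is cancelled by adding a nonnegative multiple
    -- of v. What remains is (i + 1) (k + 1) u, and the witness is this factor minus 1.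
    lift (i , Su′) = k ℕ.+ i ℕ.* suc k , subst S
      (trans (cancel (+ suc i) (+ suc k) (l ∙ u) u v) (cong (_⊛ u) (sym (ℤP.pos-* (suc i) (suc k)))))
      (S-⊕ Su′ (S-⊛-nonneg {+ suc i ℤ.* ℤ.- (l ∙ u)}
        (subst (ℤ._≤ + suc i ℤ.* ℤ.- (l ∙ u)) (ℤP.*-zeroʳ (+ suc i)) (ℤP.*-monoˡ-≤-nonNeg (+ suc i) (ℤP.neg-mono-≤ (ℤP.<⇒≤ l<0))))
        (SV zero)))
      where
      cancel : ∀ {m} i k y (u v : Vec ℤ m) →
               i ⊛ (k ⊛ u ⊕ y ⊛ v) ⊕ (i ℤ.* ℤ.- y) ⊛ v ≡ (i ℤ.* k) ⊛ u
      cancel i k y []      []      = refl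
      cancel i k y (u ∷ us) (v ∷ vs) = cong₂ _∷_ (cancel₁ i k y u v) (cancel i k y us vs)
        where
        cancel₁ : ∀ i k y u v → i ℤ.* (k ℤ.* u ℤ.+ y ℤ.* v) ℤ.+ (i ℤ.* ℤ.- y) ℤ.* v ≡ (i ℤ.* k) ℤ.* u
        cancel₁ = solve-∀

    combine : (∃ λ l′ → (∀ j → ℤ.0ℤ ℤ.≤ l′ ∙ project (V (suc j))) × l′ ∙ project u ℤ.< ℤ.0ℤ) →
              ∃ λ l′ → (∀ j → ℤ.0ℤ ℤ.≤ l′ ∙ V j) × l′ ∙ u ℤ.< ℤ.0ℤ
    combine (l′ , l′≥0 , l′<0) = l″ , nonneg , subst (ℤ._< ℤ.0ℤ) (sym (l″-project u)) l′<0
      where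
      -- The transpose of `project` applied to `l′`; as `project` kills v, the new functional
      -- vanishes there.
      l″ = + suc k ⊛ l′ ⊕ (l′ ∙ v) ⊛ l
      l″-∙ : ∀ w → l″ ∙ w ≡ + suc k ℤ.* (l′ ∙ w) ℤ.+ (l′ ∙ v) ℤ.* (l ∙ w)
      l″-∙ w = trans (∙-comm l″ w) (trans (∙-linear w (+ suc k) l′ (l′ ∙ v) l)
        (cong₂ (λ p q → + suc k ℤ.* p ℤ.+ (l′ ∙ v) ℤ.* q) (∙-comm w l′) (∙-comm w l)))
      l″-project : ∀ w → l″ ∙ w ≡ l′ ∙ project w
      l″-project w = trans (l″-∙ w) (trans (cong (λ z → + suc k ℤ.* (l′ ∙ w) ℤ.+ z) (ℤP.*-comm (l′ ∙ v) (l ∙ w)))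
        (sym (∙-linear l′ (+ suc k) w (l ∙ w) v)))
      l″-v : l″ ∙ v ≡ ℤ.0ℤ
      l″-v = trans (l″-∙ v) (trans (cong (λ z → + suc k ℤ.* (l′ ∙ v) ℤ.+ (l′ ∙ v) ℤ.* z) l∙v) (vanish (+ suc k) (l′ ∙ v)))
        where
        vanish : ∀ x y → x ℤ.* y ℤ.+ y ℤ.* ℤ.- x ≡ ℤ.0ℤ
        vanish = solve-∀
      nonneg : ∀ j → ℤ.0ℤ ℤ.≤ l″ ∙ V j
      nonneg zero    = ℤP.≤-reflexive (sym l″-v)
      nonneg (suc j) = subst (ℤ.0ℤ ℤ.≤_) (sym (l″-project (V (suc j)))) (l′≥0 j)

-- Lattice points in rational convex hulls

ι : ℤ → ℚ
ι z = z ℚ./ 1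

ι≡mkℚ : ∀ z → ι z ≡ mkℚ z 0 (Coprimality.sym (Coprimality.1-coprimeTo ℤ.∣ z ∣))
ι≡mkℚ z = ℚP.↥p/↧p≡p (mkℚ z 0 (Coprimality.sym (Coprimality.1-coprimeTo ℤ.∣ z ∣)))

ι-+ : ∀ x y → ι (x ℤ.+ y) ≡ ι x ℚ.+ ι y
ι-+ x y rewrite ι≡mkℚ x | ι≡mkℚ y | ℤP.*-identityʳ x | ℤP.*-identityʳ y = refl

ι-* : ∀ x y → ι (x ℤ.* y) ≡ ι x ℚ.* ι y
ι-* x y rewrite ι≡mkℚ x | ι≡mkℚ y = refl

ι-neg : ∀ x → ι (ℤ.- x) ≡ ℚ.- ι x
ι-neg x = ∙-inverse (trans (sym (ι-+ (ℤ.- x) x)) (cong ι (ℤP.+-inverseˡ x)))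
  where
  open import Algebra.Properties.Group ℚP.+-0-group using (inverseˡ-unique)
  ∙-inverse : ι (ℤ.- x) ℚ.+ ι x ≡ 0ℚ → ι (ℤ.- x) ≡ ℚ.- ι x
  ∙-inverse = inverseˡ-unique (ι (ℤ.- x)) (ι x)

ι-mono-≤ : ∀ {x y} → x ℤ.≤ y → ι x ℚ.≤ ι y
ι-mono-≤ {x} {y} le rewrite ι≡mkℚ x | ι≡mkℚ y = ℚ.*≤* (ℤP.*-monoʳ-≤-nonNeg (+ 1) le)

ι-cancel-≤ : ∀ {x y} → ι x ℚ.≤ ι y → x ℤ.≤ y
ι-cancel-≤ {x} {y} le rewrite ι≡mkℚ x | ι≡mkℚ y with le
... | ℚ.*≤* le′ = ℤP.*-cancelʳ-≤-pos x y (+ 1) le′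

lookup-toℚⁿ : ∀ {n} (a : Vec ℤ n) i → V.lookup (toℚⁿ a) i ≡ ι (V.lookup a i)
lookup-toℚⁿ a i = VP.lookup-map i ι a

⟨_,_⟩ : ∀ {n} → Vec ℤ n → ℚⁿ n → ℚ
⟨ []    , []    ⟩ = 0ℚ
⟨ l ∷ ls , x ∷ xs ⟩ = ι l ℚ.* x ℚ.+ ⟨ ls , xs ⟩

⟨⟩-toℚⁿ : ∀ {n} (l a : Vec ℤ n) → ⟨ l , toℚⁿ a ⟩ ≡ ι (l ∙ a)
⟨⟩-toℚⁿ []      []      = refl
⟨⟩-toℚⁿ (l ∷ ls) (a ∷ as) = trans (cong₂ ℚ._+_ (sym (ι-* l a)) (⟨⟩-toℚⁿ ls as)) (sym (ι-+ (l ℤ.* a) (ls ∙ as)))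

⟨⟩-+ᵥ : ∀ {n} (l : Vec ℤ n) x y → ⟨ l , x +ᵥ y ⟩ ≡ ⟨ l , x ⟩ ℚ.+ ⟨ l , y ⟩
⟨⟩-+ᵥ []      []      []      = refl
⟨⟩-+ᵥ (l ∷ ls) (x ∷ xs) (y ∷ ys) = trans (cong₂ ℚ._+_ (ℚP.*-distribˡ-+ (ι l) x y) (⟨⟩-+ᵥ ls xs ys))
  (interchange (ι l ℚ.* x) (ι l ℚ.* y) ⟨ ls , xs ⟩ ⟨ ls , ys ⟩)
  where open import Algebra.Properties.CommutativeSemigroup (CommutativeMonoid.commutativeSemigroup ℚP.+-0-commutativeMonoid) using (interchange)

⟨⟩-·ᵥ : ∀ {n} (l : Vec ℤ n) c x → ⟨ l , c ·ᵥ x ⟩ ≡ c ℚ.* ⟨ l , x ⟩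
⟨⟩-·ᵥ []      c []      = sym (ℚP.*-zeroʳ c)
⟨⟩-·ᵥ (l ∷ ls) c (x ∷ xs) = trans (cong₂ ℚ._+_
  (trans (sym (ℚP.*-assoc (ι l) c x)) (trans (cong (ℚ._* x) (ℚP.*-comm (ι l) c)) (ℚP.*-assoc c (ι l) x)))
  (⟨⟩-·ᵥ ls c xs)) (sym (ℚP.*-distribˡ-+ c (ι l ℚ.* x) ⟨ ls , xs ⟩))

⟨⟩-0ᵥ : ∀ {n} (l : Vec ℤ n) → ⟨ l , 0ᵥ ⟩ ≡ 0ℚ
⟨⟩-0ᵥ []       = refl
⟨⟩-0ᵥ (l ∷ ls) = trans (cong₂ ℚ._+_ (ℚP.*-zeroʳ (ι l)) (⟨⟩-0ᵥ ls)) (ℚP.+-identityˡ 0ℚ)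

⟨⟩-Σᵥ : ∀ {m n} (l : Vec ℤ n) (F : Fin m → ℚⁿ n) → ⟨ l , Σᵥ F ⟩ ≡ Σℚ (λ j → ⟨ l , F j ⟩)
⟨⟩-Σᵥ {zero}  l F = ⟨⟩-0ᵥ l
⟨⟩-Σᵥ {suc m} l F = trans (⟨⟩-+ᵥ l (F zero) _) (cong (ℚ._+_ ⟨ l , F zero ⟩) (⟨⟩-Σᵥ l (F ∘ suc)))

Σℚ-cong : ∀ {m} {F G : Fin m → ℚ} → (∀ j → F j ≡ G j) → Σℚ F ≡ Σℚ G
Σℚ-cong {zero}  eq = refl
Σℚ-cong {suc m} eq = cong₂ ℚ._+_ (eq zero) (Σℚ-cong (eq ∘ suc))

Σℚ-mono : ∀ {m} {F G : Fin m → ℚ} → (∀ j → F j ℚ.≤ G j) → Σℚ F ℚ.≤ Σℚ G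
Σℚ-mono {zero}  le = ℚP.≤-refl
Σℚ-mono {suc m} le = ℚP.+-mono-≤ (le zero) (Σℚ-mono (le ∘ suc))

Σℚ-* : ∀ {m} (F : Fin m → ℚ) x → Σℚ (λ j → F j ℚ.* x) ≡ Σℚ F ℚ.* x
Σℚ-* {zero}  F x = sym (ℚP.*-zeroˡ x)
Σℚ-* {suc m} F x = trans (cong (ℚ._+_ (F zero ℚ.* x)) (Σℚ-* (F ∘ suc) x)) (sym (ℚP.*-distribʳ-+ x (F zero) _))

conv-lower-bound : ∀ {n m} (vs : Vec (Vec ℤ n) m) l b → (∀ j → b ℤ.≤ l ∙ V.lookup vs j) →
                   ∀ {a} → Conv vs (toℚⁿ a) → b ℤ.≤ l ∙ a
conv-lower-bound vs l b bound {a} (w , w≥0 , Σw≡1 , a≡) = ι-cancel-≤ (begin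
  ι b                                                        ≡⟨ sym (ℚP.*-identityˡ (ι b)) ⟩
  1ℚ ℚ.* ι b                                                 ≡⟨ cong (ℚ._* ι b) (sym Σw≡1) ⟩
  Σℚ w ℚ.* ι b                                               ≡⟨ sym (Σℚ-* w (ι b)) ⟩
  Σℚ (λ j → w j ℚ.* ι b)                                     ≤⟨ Σℚ-mono (λ j → ℚP.*-monoˡ-≤-nonNeg (w j) {{ℚ.nonNegative (w≥0 j)}} (ι-mono-≤ (bound j))) ⟩
  Σℚ (λ j → w j ℚ.* ι (l ∙ V.lookup vs j))                   ≡⟨ Σℚ-cong (λ j → sym (trans (⟨⟩-·ᵥ l (w j) _) (cong (w j ℚ.*_) (⟨⟩-toℚⁿ l (V.lookup vs j))))) ⟩
  Σℚ (λ j → ⟨ l , w j ·ᵥ toℚⁿ (V.lookup vs j) ⟩)             ≡⟨ sym (⟨⟩-Σᵥ l (λ j → w j ·ᵥ toℚⁿ (V.lookup vs j))) ⟩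
  ⟨ l , Σᵥ (λ j → w j ·ᵥ toℚⁿ (V.lookup vs j)) ⟩             ≡⟨ cong ⟨ l ,_⟩ (sym a≡) ⟩
  ⟨ l , toℚⁿ a ⟩                                             ≡⟨ ⟨⟩-toℚⁿ l a ⟩
  ι (l ∙ a)                                                  ∎)
  where open ℚP.≤-Reasoning

0·ᵥ : ∀ {n} (x : ℚⁿ n) → 0ℚ ·ᵥ x ≡ 0ᵥ
0·ᵥ []      = refl
0·ᵥ (x ∷ xs) = cong₂ _∷_ (ℚP.*-zeroˡ x) (0·ᵥ xs)

1·ᵥ : ∀ {n} (x : ℚⁿ n) → 1ℚ ·ᵥ x ≡ x
1·ᵥ []      = refl
1·ᵥ (x ∷ xs) = cong₂ _∷_ (ℚP.*-identityˡ x) (1·ᵥ xs)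

Σᵥ-zero : ∀ {m n} (F : Fin m → ℚⁿ n) → (∀ j → F j ≡ 0ᵥ) → Σᵥ F ≡ 0ᵥ
Σᵥ-zero {zero}  F eq = refl
Σᵥ-zero {suc m} F eq = trans (cong₂ _+ᵥ_ (eq zero) (Σᵥ-zero (F ∘ suc) (eq ∘ suc)))
  (VP.zipWith-identityˡ ℚP.+-identityˡ 0ᵥ)

Σℚ-zero : ∀ {m} → Σℚ {m} (λ _ → 0ℚ) ≡ 0ℚ
Σℚ-zero {zero}  = refl
Σℚ-zero {suc m} = trans (ℚP.+-identityˡ _) (Σℚ-zero {m})

conv-vertex : ∀ {n m} (vs : Vec (Vec ℤ n) m) j → Conv vs (toℚⁿ (V.lookup vs j))
conv-vertex {m = suc m} (v ∷ vs) zero = (λ { zero → 1ℚ ; (suc _) → 0ℚ }) ,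
  (λ { zero → ℚP.nonNegative⁻¹ 1ℚ ; (suc _) → ℚP.≤-refl }) ,
  trans (cong (ℚ._+_ 1ℚ) (Σℚ-zero {m})) (ℚP.+-identityʳ 1ℚ) ,
  sym (trans (cong₂ _+ᵥ_ (1·ᵥ (toℚⁿ v)) (Σᵥ-zero _ (λ j → 0·ᵥ (toℚⁿ (V.lookup vs j)))))
             (VP.zipWith-identityʳ ℚP.+-identityʳ (toℚⁿ v)))
conv-vertex (v ∷ vs) (suc j) with conv-vertex vs j
... | w , w≥0 , Σw≡1 , eq = (λ { zero → 0ℚ ; (suc i) → w i }) ,
  (λ { zero → ℚP.≤-refl ; (suc i) → w≥0 i }) ,
  trans (ℚP.+-identityˡ _) Σw≡1 ,
  trans eq (sym (trans (cong (_+ᵥ x) (0·ᵥ (toℚⁿ v))) (VP.zipWith-identityˡ ℚP.+-identityˡ x)))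
  where x = Σᵥ (λ j → w j ·ᵥ toℚⁿ (V.lookup vs j))

-- Absolute values and reflections of integer vectors

lookup-ext : ∀ {A : Set} {m} {a b : Vec A m} → (∀ i → V.lookup a i ≡ V.lookup b i) → a ≡ b
lookup-ext {a = a} {b} eq = trans (sym (VP.tabulate∘lookup a)) (trans (VP.tabulate-cong eq) (VP.tabulate∘lookup b))

infix 4 _≤ᵥ_
_≤ᵥ_ : ∀ {m} → Vec ℤ m → Vec ℤ m → Set
a ≤ᵥ b = ∀ i → V.lookup a i ℤ.≤ V.lookup b i

lookup-⊕ : ∀ {m} (a b : Vec ℤ m) i → V.lookup (a ⊕ b) i ≡ V.lookup a i ℤ.+ V.lookup b i
lookup-⊕ a b i = VP.lookup-zipWith ℤ._+_ i a b

lookup-0ℤᵥ : ∀ {m} i → V.lookup (0ℤᵥ {m}) i ≡ ℤ.0ℤ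
lookup-0ℤᵥ i = VP.lookup-replicate i ℤ.0ℤ

Nonneg : ∀ {m} → Vec ℤ m → Set
Nonneg a = ∀ i → ℤ.0ℤ ℤ.≤ V.lookup a i

abs : ℤ → ℤ
abs z = + ℤ.∣ z ∣

absᵥ : ∀ {m} → Vec ℤ m → Vec ℤ m
absᵥ = V.map abs

absᵥ-nonneg : ∀ {m} (a : Vec ℤ m) → Nonneg (absᵥ a)
absᵥ-nonneg a i rewrite VP.lookup-map i abs a = ℤ.+≤+ ℕ.z≤n

absᵥ-id : ∀ {m} {a : Vec ℤ m} → Nonneg a → absᵥ a ≡ a
absᵥ-id {a = a} 0≤a = lookup-ext λ i → trans (VP.lookup-map i abs a)
  (ℤP.0≤i⇒+∣i∣≡i (0≤a i))

absᵥ-⊕ : ∀ {m} (a b : Vec ℤ m) → absᵥ (a ⊕ b) ≤ᵥ absᵥ a ⊕ absᵥ b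
absᵥ-⊕ a b i rewrite lookup-⊕ (absᵥ a) (absᵥ b) i | VP.lookup-map i abs (a ⊕ b) | lookup-⊕ a b i
  | VP.lookup-map i abs a | VP.lookup-map i abs b = ℤ.+≤+ (ℤP.∣i+j∣≤∣i∣+∣j∣ (V.lookup a i) (V.lookup b i))

signℤ : Sign → ℤ → ℤ
signℤ Sign.+ z = z
signℤ Sign.- z = ℤ.- z

signᵥ : ∀ {m} → Vec Sign m → Vec ℤ m → Vec ℤ m
signᵥ = V.zipWith signℤ

signs : ∀ {m} → Vec ℤ m → Vec Sign m
signs = V.map ℤ.sign

signℤ-+ : ∀ s x y → signℤ s (x ℤ.+ y) ≡ signℤ s x ℤ.+ signℤ s y
signℤ-+ Sign.+ x y = refl
signℤ-+ Sign.- x y = ℤP.neg-distrib-+ x y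

signᵥ-⊕ : ∀ {m} (ε : Vec Sign m) a b → signᵥ ε (a ⊕ b) ≡ signᵥ ε a ⊕ signᵥ ε b
signᵥ-⊕ []      []      []      = refl
signᵥ-⊕ (s ∷ ε) (x ∷ a) (y ∷ b) = cong₂ _∷_ (signℤ-+ s x y) (signᵥ-⊕ ε a b)

signᵥ-0 : ∀ {m} (ε : Vec Sign m) → signᵥ ε 0ℤᵥ ≡ 0ℤᵥ
signᵥ-0 []           = refl
signᵥ-0 (Sign.+ ∷ ε) = cong (ℤ.0ℤ ∷_) (signᵥ-0 ε)
signᵥ-0 (Sign.- ∷ ε) = cong (ℤ.0ℤ ∷_) (signᵥ-0 ε)

signᵥ-absᵥ : ∀ {m} (a : Vec ℤ m) → signᵥ (signs a) (absᵥ a) ≡ a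
signᵥ-absᵥ []             = refl
signᵥ-absᵥ (+ k ∷ a)      = cong (+ k ∷_) (signᵥ-absᵥ a)
signᵥ-absᵥ (-[1+ k ] ∷ a) = cong (-[1+ k ] ∷_) (signᵥ-absᵥ a)

signᵥ-signs : ∀ {m} (a : Vec ℤ m) → signᵥ (signs a) a ≡ absᵥ a
signᵥ-signs []             = refl
signᵥ-signs (+ k ∷ a)      = cong (+ k ∷_) (signᵥ-signs a)
signᵥ-signs (-[1+ k ] ∷ a) = cong (+ suc k ∷_) (signᵥ-signs a)

absᵥ-signᵥ : ∀ {m} (ε : Vec Sign m) a → absᵥ (signᵥ ε a) ≡ absᵥ a
absᵥ-signᵥ []           []      = refl
absᵥ-signᵥ (Sign.+ ∷ ε) (x ∷ a) = cong (abs x ∷_) (absᵥ-signᵥ ε a)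
absᵥ-signᵥ (Sign.- ∷ ε) (x ∷ a) = cong₂ _∷_ (cong +_ (ℤP.∣-i∣≡∣i∣ x)) (absᵥ-signᵥ ε a)

ι-signℤ : ∀ s z → ι (signℤ s z) ≡ signℚ s (ι z)
ι-signℤ Sign.+ z = refl
ι-signℤ Sign.- z = ι-neg z

toℚⁿ-signᵥ : ∀ {m} (ε : Vec Sign m) a → toℚⁿ (signᵥ ε a) ≡ ε ⊙ toℚⁿ a
toℚⁿ-signᵥ []      []      = refl
toℚⁿ-signᵥ (s ∷ ε) (x ∷ a) = cong₂ _∷_ (ι-signℤ s x) (toℚⁿ-signᵥ ε a)

⊙-involutive : ∀ {m} (ε : Vec Sign m) x → ε ⊙ (ε ⊙ x) ≡ x
⊙-involutive []           []      = refl
⊙-involutive (Sign.+ ∷ ε) (x ∷ xs) = cong (x ∷_) (⊙-involutive ε xs)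
⊙-involutive (Sign.- ∷ ε) (x ∷ xs) = cong₂ _∷_ (⁻¹-involutive x) (⊙-involutive ε xs)
  where open import Algebra.Properties.Group ℚP.+-0-group using (⁻¹-involutive)

signℤ≤abs : ∀ s z → signℤ s z ℤ.≤ abs z
signℤ≤abs Sign.+ (+ k)    = ℤP.≤-refl
signℤ≤abs Sign.+ -[1+ k ] = ℤ.-≤+
signℤ≤abs Sign.- (+ zero) = ℤP.≤-refl
signℤ≤abs Sign.- (+ suc k) = ℤ.-≤+
signℤ≤abs Sign.- -[1+ k ] = ℤP.≤-refl

negativePart : ∀ {m} → Vec ℤ m → Vec ℤ m
negativePart []             = []
negativePart (+ k ∷ l)      = ℤ.0ℤ ∷ negativePart l
negativePart (-[1+ k ] ∷ l) = -[1+ k ] ∷ negativePart l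

-- For nonnegative a, a minimiser of l on the box between 0 and a. An anti-blocking polytope that
-- contains a contains it too, so a lower bound for l on the polytope is one for `negativePart l`.
clearPositive : ∀ {m} → Vec ℤ m → Vec ℤ m → Vec ℤ m
clearPositive []             []      = []
clearPositive (+ k ∷ l)      (x ∷ a) = ℤ.0ℤ ∷ clearPositive l a
clearPositive (-[1+ k ] ∷ l) (x ∷ a) = x ∷ clearPositive l a

clearPositive-bounds : ∀ {m} (l a : Vec ℤ m) → Nonneg a → Nonneg (clearPositive l a) × clearPositive l a ≤ᵥ a
clearPositive-bounds []      []      0≤a = (λ ()) , (λ ())
clearPositive-bounds (x ∷ l) (y ∷ a) 0≤a with clearPositive-bounds l a (0≤a ∘ suc)
clearPositive-bounds (+ k ∷ l)      (y ∷ a) 0≤a | lower , upper =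
  (λ { zero → ℤP.≤-refl ; (suc i) → lower i }) , (λ { zero → 0≤a zero ; (suc i) → upper i })
clearPositive-bounds (-[1+ k ] ∷ l) (y ∷ a) 0≤a | lower , upper =
  (λ { zero → 0≤a zero ; (suc i) → lower i }) , (λ { zero → ℤP.≤-refl ; (suc i) → upper i })

-- With a negative coefficient, a coordinate of given absolute value contributes least when it is
-- nonnegative, so reflections only increase the pairing.
∙-clearPositive : ∀ {m} (l : Vec ℤ m) ε a → l ∙ clearPositive l (absᵥ a) ℤ.≤ negativePart l ∙ signᵥ ε a
∙-clearPositive []             []      []      = ℤP.≤-refl
∙-clearPositive (+ k ∷ l)      (s ∷ ε) (x ∷ a) = ℤP.+-mono-≤
  (ℤP.≤-reflexive (trans (ℤP.*-zeroʳ (+ k)) (sym (ℤP.*-zeroˡ (signℤ s x))))) (∙-clearPositive l ε a)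
∙-clearPositive (-[1+ k ] ∷ l) (s ∷ ε) (x ∷ a) = ℤP.+-mono-≤
  (ℤP.*-monoˡ-≤-nonPos -[1+ k ] (signℤ≤abs s x)) (∙-clearPositive l ε a)

negativePart-∙ : ∀ {m} (l a : Vec ℤ m) → negativePart l ∙ absᵥ a ℤ.≤ l ∙ absᵥ a
negativePart-∙ []             []      = ℤP.≤-refl
negativePart-∙ (+ k ∷ l)      (x ∷ a) = ℤP.+-mono-≤
  (subst (ℤ._≤ + k ℤ.* abs x) (trans (ℤP.*-zeroʳ (+ k)) (sym (ℤP.*-zeroˡ (abs x))))
    (ℤP.*-monoˡ-≤-nonNeg (+ k) {+ 0} {abs x} (ℤ.+≤+ ℕ.z≤n))) (negativePart-∙ l a)
negativePart-∙ (-[1+ k ] ∷ l) (x ∷ a) = ℤP.+-monoʳ-≤ (-[1+ k ] ℤ.* abs x) (negativePart-∙ l a)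

-- The monoids of K[P] and K[P±]

module Monoids {c ℓ} (K : Field c ℓ) (n : ℕ) where
  open Laurent K n
  open Polynomials K n
  open Relations K n

  InMonoid-+ : ∀ {Q e e′} → InMonoid Q e → InMonoid Q e′ → InMonoid Q (e +ₑ e′)
  InMonoid-+ {Q} {e′ = e′} [] m′ = subst (InMonoid Q) (sym (+ₑ-identityˡ e′)) m′
  InMonoid-+ {Q} {e′ = e′} (_∷_ {a} {e} q m) m′ =
    subst (InMonoid Q) (sym (+ₑ-assoc (a , 1) e e′)) (q ∷ InMonoid-+ m m′)

  InMonoid-× : ∀ {Q e} k → InMonoid Q e → InMonoid Q (k ×ₑ e)
  InMonoid-× zero    m = []
  InMonoid-× (suc k) m = InMonoid-+ m (InMonoid-× k m)

  generator : ∀ {Q} a → Q (toℚⁿ a) → InMonoid Q (a , 1)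
  generator {Q} a q = subst (InMonoid Q) (+ₑ-identityʳ (a , 1)) (q ∷ [])

  ×ₑ≡ : ∀ k a l → k ×ₑ (a , l) ≡ (+ k ⊛ a , k ℕ.* l)
  ×ₑ≡ zero    a l = cong (_, 0) (sym (0-⊛ a))
  ×ₑ≡ (suc k) a l = trans (cong ((a , l) +ₑ_) (×ₑ≡ k a l))
    (cong (_, l ℕ.+ k ℕ.* l) (sym (trans (⊛-⊕ˡ ℤ.1ℤ (+ k) a) (cong (_⊕ + k ⊛ a) (1-⊛ a)))))

  weight-nonneg : ∀ {Q} (W : Weight) → (∀ a → Q (toℚⁿ a) → ℤ.0ℤ ℤ.≤ Weight.weight W (a , 1)) →
                  ∀ {e} → InMonoid Q e → ℤ.0ℤ ℤ.≤ Weight.weight W e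
  weight-nonneg W h []                = ℤP.≤-reflexive (sym (Weight.weight-0 W))
  weight-nonneg W h (_∷_ {a} {e} q m) = subst (ℤ.0ℤ ℤ.≤_) (sym (Weight.weight-+ W (a , 1) e))
    (ℤP.+-mono-≤ (h a q) (weight-nonneg W h m))

  coordinateWeight : Fin n → Weight
  coordinateWeight i = record
    { weight = λ e → V.lookup (proj₁ e) i ; weight-+ = λ e e′ → lookup-⊕ (proj₁ e) (proj₁ e′) i }

  degreeWeight : Weight
  degreeWeight = record { weight = λ e → + proj₂ e ; weight-+ = λ e e′ → ℤP.pos-+ (proj₂ e) (proj₂ e′) }

  module AntiBlockingMonoid (P : ℚⁿ n → Set) (antiBlocking : AntiBlocking P) where

    P-nonneg : ∀ {a} → P (toℚⁿ a) → Nonneg a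
    P-nonneg {a} p i = ι-cancel-≤ (subst (0ℚ ℚ.≤_) (lookup-toℚⁿ a i) (proj₁ antiBlocking _ p i))

    P-down : ∀ {a b} → P (toℚⁿ b) → Nonneg a → a ≤ᵥ b → P (toℚⁿ a)
    P-down {a} {b} p 0≤a a≤b = proj₂ antiBlocking (toℚⁿ b) (toℚⁿ a) p λ i →
      subst (0ℚ ℚ.≤_) (sym (lookup-toℚⁿ a i)) (ι-mono-≤ {+ 0} (0≤a i)) ,
      ≡.subst₂ ℚ._≤_ (sym (lookup-toℚⁿ a i)) (sym (lookup-toℚⁿ b i)) (ι-mono-≤ (a≤b i))

    P-origin : ∀ {x} → P x → P (toℚⁿ 0ℤᵥ)
    P-origin {x} p = proj₂ antiBlocking x (toℚⁿ 0ℤᵥ) p λ i →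
      subst (λ z → 0ℚ ℚ.≤ z × z ℚ.≤ V.lookup x i) (sym (trans (lookup-toℚⁿ 0ℤᵥ i) (cong ι (lookup-0ℤᵥ i))))
        (ℚP.≤-refl , proj₁ antiBlocking x p i)

    -- Reflecting a by ε once more gives the point of P that it came from. That point is
    -- nonnegative, hence its own absolute value, and absolute values ignore ε.
    P±⇒P : ∀ {a} → (P ^±) (toℚⁿ a) → P (toℚⁿ (absᵥ a))
    P±⇒P {a} (ε , x , p , eq) = subst (P ∘ toℚⁿ) (trans (sym (absᵥ-id (P-nonneg p′))) (absᵥ-signᵥ ε a)) p′
      where
      p′ : P (toℚⁿ (signᵥ ε a))
      p′ = subst P (sym (trans (toℚⁿ-signᵥ ε a) (trans (cong (ε ⊙_) eq) (⊙-involutive ε x)))) p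

    InMonoid-nonneg : ∀ {e} → InMonoid P e → Nonneg (proj₁ e)
    InMonoid-nonneg m i = weight-nonneg (coordinateWeight i) (λ a p → P-nonneg p i) m

    -- Take as much of a as fits below the first generator, and distribute the rest.
    InMonoid-down : ∀ {e} → InMonoid P e → ∀ a → Nonneg a → a ≤ᵥ proj₁ e → InMonoid P (a , proj₂ e)
    InMonoid-down [] a 0≤a a≤0 = subst (λ z → InMonoid P (z , 0))
      (lookup-ext λ i → ℤP.≤-antisym (subst (ℤ._≤ V.lookup a i) (sym (lookup-0ℤᵥ i)) (0≤a i)) (a≤0 i)) []
    InMonoid-down (_∷_ {b} {e , k} p m) a 0≤a a≤b+e = subst (λ z → InMonoid P (z , suc k)) (lookup-ext split)
      (P-down {fst} p fst≥0 fst≤b ∷ InMonoid-down m rest rest≥0 rest≤e)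
      where
      fst rest : Vec ℤ n
      fst  = V.zipWith ℤ._⊓_ a b
      rest = V.zipWith ℤ._-_ a fst
      fst-at : ∀ i → V.lookup fst i ≡ V.lookup a i ℤ.⊓ V.lookup b i
      fst-at i = VP.lookup-zipWith ℤ._⊓_ i a b
      rest-at : ∀ i → V.lookup rest i ≡ V.lookup a i ℤ.- V.lookup fst i
      rest-at i = VP.lookup-zipWith ℤ._-_ i a fst
      fst≥0 : Nonneg fst
      fst≥0 i = subst (ℤ.0ℤ ℤ.≤_) (sym (fst-at i)) (ℤP.⊓-glb (0≤a i) (P-nonneg p i))
      fst≤b : fst ≤ᵥ b
      fst≤b i = subst (ℤ._≤ V.lookup b i) (sym (fst-at i)) (ℤP.i⊓j≤j _ _)
      rest≥0 : Nonneg rest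
      rest≥0 i = subst (ℤ.0ℤ ℤ.≤_) (sym (rest-at i)) (ℤP.i≤j⇒0≤j-i
        (subst (ℤ._≤ V.lookup a i) (sym (fst-at i)) (ℤP.i⊓j≤i (V.lookup a i) (V.lookup b i))))
      rest≤e : rest ≤ᵥ e
      rest≤e i = subst (ℤ._≤ V.lookup e i) (sym (trans (rest-at i) (cong (λ z → V.lookup a i ℤ.- z) (fst-at i))))
        (bound (V.lookup a i) (V.lookup b i) (V.lookup e i) (subst (V.lookup a i ℤ.≤_) (lookup-⊕ b e i) (a≤b+e i)) (InMonoid-nonneg m i))
        where
        bound : ∀ x y z → x ℤ.≤ y ℤ.+ z → ℤ.0ℤ ℤ.≤ z → x ℤ.- (x ℤ.⊓ y) ℤ.≤ z
        bound x y z x≤y+z 0≤z with ℤP.≤-total x y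
        ... | inj₁ x≤y rewrite ℤP.i≤j⇒i⊓j≡i x≤y | ℤP.+-inverseʳ x = 0≤z
        ... | inj₂ y≤x rewrite ℤP.i≥j⇒i⊓j≡j y≤x = subst (x ℤ.- y ℤ.≤_) (cancel y z) (ℤP.+-monoˡ-≤ (ℤ.- y) x≤y+z)
          where
          cancel : ∀ y z → y ℤ.+ z ℤ.- y ≡ z
          cancel = solve-∀
      split : ∀ i → V.lookup (fst ⊕ rest) i ≡ V.lookup a i
      split i = trans (lookup-⊕ fst rest i) (trans (cong (λ z → V.lookup fst i ℤ.+ z) (rest-at i)) (cancel (V.lookup fst i) (V.lookup a i)))
        where
        cancel : ∀ x y → x ℤ.+ (y ℤ.- x) ≡ y
        cancel = solve-∀

    -- Triangle inequality: cancellation between generators of different orthants only shrinks the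
    -- absolute value, and M is closed downwards.
    InMonoid±⇒InMonoid : ∀ {e} → InMonoid (P ^±) e → InMonoid P (absᵥ (proj₁ e) , proj₂ e)
    InMonoid±⇒InMonoid [] = subst (λ z → InMonoid P (z , 0)) (sym (absᵥ-id {a = 0ℤᵥ} (λ i → ℤP.≤-reflexive (sym (lookup-0ℤᵥ i))))) []
    InMonoid±⇒InMonoid (_∷_ {a} {e , k} q m) =
      InMonoid-down (P±⇒P q ∷ InMonoid±⇒InMonoid m) (absᵥ (a ⊕ e)) (absᵥ-nonneg (a ⊕ e)) (absᵥ-⊕ a e)

    InMonoid⇒signed : ∀ ε {e} → InMonoid P e → InMonoid (P ^±) (signᵥ ε (proj₁ e) , proj₂ e)
    InMonoid⇒signed ε [] = subst (λ z → InMonoid (P ^±) (z , 0)) (sym (signᵥ-0 ε)) []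
    InMonoid⇒signed ε (_∷_ {a} {e , k} p m) = subst (λ z → InMonoid (P ^±) (z , suc k)) (sym (signᵥ-⊕ ε a e))
      ((ε , toℚⁿ a , p , toℚⁿ-signᵥ ε a) ∷ InMonoid⇒signed ε m)

    abs⇒InMonoid± : ∀ {a k} → InMonoid P (absᵥ a , k) → InMonoid (P ^±) (a , k)
    abs⇒InMonoid± {a} {k} m = subst (λ z → InMonoid (P ^±) (z , k)) (signᵥ-absᵥ a) (InMonoid⇒signed (signs a) m)

    InMonoid⇒InMonoid± : ∀ {e} → InMonoid P e → InMonoid (P ^±) e
    InMonoid⇒InMonoid± {a , k} m = abs⇒InMonoid± (subst (λ z → InMonoid P (z , k)) (sym (absᵥ-id (InMonoid-nonneg m))) m)

    -- e + ∣e∣ ≤ 2 ∣e∣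
    shift-InMonoid : ∀ {e} → InMonoid (P ^±) e → InMonoid P ((absᵥ (proj₁ e) , proj₂ e) +ₑ e)
    shift-InMonoid {a , k} m = InMonoid-down (InMonoid-+ m′ m′) (absᵥ a ⊕ a) lower upper
      where
      m′ = InMonoid±⇒InMonoid m
      lower : Nonneg (absᵥ a ⊕ a)
      lower i rewrite lookup-⊕ (absᵥ a) a i | VP.lookup-map i abs a = abs+ (V.lookup a i)
        where
        abs+ : ∀ z → ℤ.0ℤ ℤ.≤ abs z ℤ.+ z
        abs+ (+ k)    = ℤ.+≤+ ℕ.z≤n
        abs+ -[1+ k ] = ℤP.≤-reflexive (sym (ℤP.+-inverseʳ (+ suc k)))
      upper : absᵥ a ⊕ a ≤ᵥ absᵥ a ⊕ absᵥ a
      upper i rewrite lookup-⊕ (absᵥ a) a i | lookup-⊕ (absᵥ a) (absᵥ a) i | VP.lookup-map i abs a =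
        ℤP.+-monoʳ-≤ (abs (V.lookup a i)) (signℤ≤abs Sign.+ (V.lookup a i))

    -- A certificate of non-membership instead of a negation, because pruning consumes the weight.
    Separated : (ℚⁿ n → Set) → Exp → Set
    Separated Q e = Σ Weight λ W → (∀ {e′} → InMonoid Q e′ → ℤ.0ℤ ℤ.≤ Weight.weight W e′) × Weight.weight W e ℤ.< ℤ.0ℤ

    -- M is the part of M± in the nonnegative orthant, so a negative coordinate is a certificate.
    InMonoid±-decide : ∀ {e} → InMonoid (P ^±) e → InMonoid P e ⊎ Separated P e
    InMonoid±-decide {a , k} m with FinP.all? (λ i → ℤ.0ℤ ℤ.≤? V.lookup a i)
    ... | yes 0≤a = inj₁ (subst (λ z → InMonoid P (z , k))
            (absᵥ-id 0≤a) (InMonoid±⇒InMonoid m))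
    ... | no ¬0≤a with FinP.¬∀⟶∃¬ n _ (λ i → ℤ.0ℤ ℤ.≤? V.lookup a i) ¬0≤a
    ...   | i , a<0 = inj₂ (coordinateWeight i ,
            (λ m′ → InMonoid-nonneg m′ i) , ℤP.≰⇒> a<0)

    Saturated : Set
    Saturated = ∀ N {e} → Nonneg (proj₁ e) → InMonoid P (suc N ×ₑ e) → InMonoid P e

  -- Separation from the monoid of P±

  module Cone {m} (vs : Vec (Vec ℤ n) m) (antiBlocking : AntiBlocking (Conv vs)) where
    open AntiBlockingMonoid (Conv vs) antiBlocking

    -- A functional that is nonnegative on the vertices stays so after dropping its
    -- positive coefficients, since P is anti-blocking; it then also survives the
    -- reflection into the orthant of a.
    signedWeight : ∀ (l₀ : ℤ) (l : Vec ℤ n) (ε : Vec Sign n) → Weight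
    signedWeight l₀ l ε = record
      { weight   = λ e → l₀ ℤ.* + proj₂ e ℤ.+ negativePart l ∙ signᵥ ε (proj₁ e)
      ; weight-+ = λ (a , j) (b , k) → trans
          (cong₂ (λ x y → l₀ ℤ.* x ℤ.+ y) (ℤP.pos-+ j k)
            (trans (cong (negativePart l ∙_) (signᵥ-⊕ ε a b)) (∙-⊕ (negativePart l) (signᵥ ε a) (signᵥ ε b))))
          (rearrange l₀ (+ j) (+ k) _ _) }
      where
      rearrange : ∀ l x y u v → l ℤ.* (x ℤ.+ y) ℤ.+ (u ℤ.+ v) ≡ (l ℤ.* x ℤ.+ u) ℤ.+ (l ℤ.* y ℤ.+ v)
      rearrange = solve-∀

    -- Farkas' lemma is applied to ∣a∣ at height k, in the cone over the vertices at height 1. A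
    -- positive multiple in M is brought down by saturation and reflected back to a.
    cone-decide : Saturated → ∀ e → InMonoid (Conv vs ^±) e ⊎ Separated (Conv vs ^±) e
    cone-decide saturated (a , k) with farkas S S-0 S-⊕ m (λ j → ℤ.1ℤ ∷ V.lookup vs j) S-vertex (+ k ∷ absᵥ a)
      where
      S : Vec ℤ (suc n) → Set
      S (z ∷ b) = Σ ℕ λ j → z ≡ + j × InMonoid (Conv vs) (b , j)
      S-0 : S 0ℤᵥ
      S-0 = 0 , refl , []
      S-⊕ : ∀ {a b} → S a → S b → S (a ⊕ b)
      S-⊕ {_ ∷ _} {_ ∷ _} (i , refl , m) (j , refl , m′) = i ℕ.+ j , refl , InMonoid-+ m m′
      S-vertex : ∀ j → S (ℤ.1ℤ ∷ V.lookup vs j)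
      S-vertex j = 1 , refl , generator (V.lookup vs j) (conv-vertex vs j)
    ... | inj₁ (N , j , eq , mem) = inj₁ (abs⇒InMonoid± (saturated N (absᵥ-nonneg a) (subst (InMonoid (Conv vs))
            (trans (cong (+ suc N ⊛ absᵥ a ,_) (ℤP.+-injective (trans (sym eq) (sym (ℤP.pos-* (suc N) k))))) (sym (×ₑ≡ (suc N) (absᵥ a) k))) mem)))
    ... | inj₂ (l₀ ∷ l , l≥0 , l<0) = inj₂ (W , weight-nonneg W onGenerators , separates)
      where
      ε = signs a
      W = signedWeight l₀ l ε
      below : ∀ {x y} → ℤ.0ℤ ℤ.≤ x ℤ.* ℤ.1ℤ ℤ.+ y → ℤ.- x ℤ.≤ y
      below {x} {y} 0≤ = subst (ℤ.- x ℤ.≤_) (cancel x y) (subst (ℤ._≤ ℤ.- x ℤ.+ (x ℤ.* ℤ.1ℤ ℤ.+ y)) (ℤP.+-identityʳ (ℤ.- x)) (ℤP.+-monoʳ-≤ (ℤ.- x) 0≤))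
        where
        cancel : ∀ x y → ℤ.- x ℤ.+ (x ℤ.* ℤ.1ℤ ℤ.+ y) ≡ y
        cancel = solve-∀
      above : ∀ {x y} → ℤ.- x ℤ.≤ y → ℤ.0ℤ ℤ.≤ x ℤ.* ℤ.1ℤ ℤ.+ y
      above {x} {y} le = subst (ℤ._≤ x ℤ.* ℤ.1ℤ ℤ.+ y) (cancel x) (ℤP.+-monoʳ-≤ (x ℤ.* ℤ.1ℤ) le)
        where
        cancel : ∀ x → x ℤ.* ℤ.1ℤ ℤ.+ ℤ.- x ≡ ℤ.0ℤ
        cancel = solve-∀
      onGenerators : ∀ b → (Conv vs ^±) (toℚⁿ b) → ℤ.0ℤ ℤ.≤ Weight.weight W (b , 1)
      onGenerators b q = above (ℤP.≤-trans
        (conv-lower-bound vs l (ℤ.- l₀) (λ j → below (l≥0 j))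
          (P-down (P±⇒P q) (proj₁ bounds) (proj₂ bounds)))
        (∙-clearPositive l ε b))
        where bounds = clearPositive-bounds l (absᵥ b) (absᵥ-nonneg b)
      -- The signs were taken from a itself, so here the reflection produces ∣a∣, where
      -- `negativePart l` is at most l.
      separates : Weight.weight W (a , k) ℤ.< ℤ.0ℤ
      separates = ℤP.≤-<-trans (ℤP.+-monoʳ-≤ (l₀ ℤ.* + k)
        (subst (λ z → negativePart l ∙ z ℤ.≤ l ∙ absᵥ a) (sym (signᵥ-signs a)) (negativePart-∙ l a))) l<0

-- Normality and the pruning of quotients

module Normality {c ℓ} (K : Field c ℓ) (n : ℕ) where
  open Laurent K n
  open Polynomials K n
  open Relations K n
  open Monoids K n
  open IntegralRelations polyRing
  open K using (Carrier; _≈_; _+_; _*_; 0#; 1#)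
  import Algebra.Properties.CommutativeSemiring.Exp R.commutativeSemiring as RE
  open import Algebra.Properties.Semiring.Sum R.semiring using (sum)
  open import Algebra.Properties.CommutativeSemigroup R.*-commutativeSemigroup using (x∙yz≈y∙xz)
  open import Algebra.Properties.Ring K.ring using (-1*x≈-x)
  import Relation.Binary.Reasoning.Setoid as SetoidReasoning

  x^ : Exp → LP
  x^ e = monomial 1# e

  eval-x^-* : ∀ y p φ → eval (x^ y *ₗ p) φ ≈ eval p (λ e → φ (y +ₑ e))
  eval-x^-* y p φ = K.trans (eval-monomial-* 1# y p φ) (K.*-identityˡ _)

  coeff-x^-* : ∀ y p e → coeff (x^ y *ₗ p) (y +ₑ e) ≈ coeff p e
  coeff-x^-* y p e = begin
    coeff (x^ y *ₗ p) (y +ₑ e)                ≈⟨ coeff-eval (x^ y *ₗ p) (y +ₑ e) ⟩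
    eval (x^ y *ₗ p) (δ (y +ₑ e))             ≈⟨ eval-x^-* y p (δ (y +ₑ e)) ⟩
    eval p (λ e′ → δ (y +ₑ e) (y +ₑ e′))      ≈⟨ eval-cong p (λ e′ → δ-⇔ (+ₑ-cancelˡ y) (cong (y +ₑ_))) ⟩
    eval p (δ e)                              ≈⟨ K.sym (coeff-eval p e) ⟩
    coeff p e                                 ∎
    where open SetoidReasoning K.setoid

  -- A monomial involving s has no inverse, but it is regular because shifting exponents by y is
  -- injective.
  x^-cancel : ∀ y {p q} → x^ y *ₗ p ≋ x^ y *ₗ q → p ≋ q
  x^-cancel y {p} {q} eq = ≈ₗ⇒≋ p q λ e →
    K.trans (K.sym (coeff-x^-* y p e)) (K.trans (≋⇒≈ₗ eq (y +ₑ e)) (coeff-x^-* y q e))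

  coeff-monomial : ∀ a e → coeff (monomial a e) e ≈ a
  coeff-monomial a e = K.trans (coeff-eval (monomial a e) e)
    (K.trans (K.+-identityʳ _) (K.trans (K.*-congˡ (δ-≡ {e} refl)) (K.*-identityʳ a)))

  x^≉0 : ∀ e → ¬ x^ e ≋ []
  x^≉0 e eq = K.0≉1 (K.sym (K.trans (K.sym (coeff-monomial 1# e)) (≋⇒≈ₗ eq e)))

  eval-x^-^ : ∀ e k φ → eval (x^ e RE.^ k) φ ≈ φ (k ×ₑ e)
  eval-x^-^ e zero    φ = K.trans (K.+-identityʳ _) (K.*-identityˡ _)
  eval-x^-^ e (suc k) φ = K.trans (eval-x^-* e (x^ e RE.^ k) φ) (eval-x^-^ e k _)

  ×ₑ-distrib-+ₑ : ∀ k e e′ → k ×ₑ (e +ₑ e′) ≡ (k ×ₑ e) +ₑ (k ×ₑ e′)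
  ×ₑ-distrib-+ₑ zero    e e′ = sym (+ₑ-identityˡ 0ₑ)
  ×ₑ-distrib-+ₑ (suc k) e e′ = trans (cong ((e +ₑ e′) +ₑ_) (×ₑ-distrib-+ₑ k e e′)) (+ₑ-interchange e e′ _ _)

  -- The monic polynomial of degree 0 is 1 and has no root, so `Normal` may speak of degrees
  -- `suc d`.
  relation₀≉0 : ∀ {cs f g} → ¬ relation 0 cs f g ≋ []
  relation₀≉0 eq = x^≉0 0ₑ eq

  -- IsNormal for elements of K[Q] given by lists of terms that literally lie in the monoid.
  Normal : (ℚⁿ n → Set) → Set (c ⊔ ℓ)
  Normal Q = ∀ {f g} → Supp (InMonoid Q) f → Supp (InMonoid Q) g → ¬ g ≋ [] →
             ∀ d {cs} → (∀ i → Supp (InMonoid Q) (cs i)) → relation (suc d) cs f g ≋ [] →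
             ∃ λ h → Supp (InMonoid Q) h × f ≋ h *ₗ g

  IsNormal⇒Normal : ∀ {Q} → IsNormal Q → Normal Q
  IsNormal⇒Normal normal {f} {g} f∈ g∈ g≉0 d {cs} cs∈ eq
    with normal f g (f , f∈ , λ _ → K.refl) (g , g∈ , λ _ → K.refl) (λ g≈0 → g≉0 (≈ₗ⇒≋ g [] g≈0))
           (suc d) cs (λ i → cs i , cs∈ i , λ _ → K.refl)
           (≋⇒≈ₗ (R.trans (relationₗ≋relation (suc d) cs f g) eq))
  ... | h , (p , p∈ , p≈h) , f≈hg = p , p∈ ,
    R.trans (≈ₗ⇒≋ f (h *ₗ g) f≈hg) (*ₗ-cong (R.sym (≈ₗ⇒≋ p h p≈h)) (R.refl {g}))

  Normal⇒IsNormal : ∀ {Q} → Normal Q → IsNormal Q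
  Normal⇒IsNormal normal f g _ _ _ zero cs _ eq =
    ⊥-elim (relation₀≉0 {cs} {f} {g} (R.trans (R.sym (relationₗ≋relation 0 cs f g)) (≈ₗ⇒≋ _ [] eq)))
  Normal⇒IsNormal normal f g (f′ , f∈ , f′≈f) (g′ , g∈ , g′≈g) g≉0 (suc d) cs cs∈ eq =
    h , (h , proj₁ (proj₂ quotient) , λ _ → K.refl) , ≋⇒≈ₗ
      (R.trans (R.sym f′≋f) (R.trans (proj₂ (proj₂ quotient)) (*ₗ-cong (R.refl {h}) g′≋g)))
    where
    f′≋f : f′ ≋ f
    f′≋f = ≈ₗ⇒≋ f′ f f′≈f
    g′≋g : g′ ≋ g
    g′≋g = ≈ₗ⇒≋ g′ g g′≈g
    cs′ : Fin (suc d) → LP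
    cs′ i = proj₁ (cs∈ i)
    quotient = normal f∈ g∈ (λ g≋0 → g≉0 (≋⇒≈ₗ (R.trans (R.sym g′≋g) g≋0))) d {cs′} (λ i → proj₁ (proj₂ (cs∈ i)))
      (R.trans (relation-cong (suc d) cs′ cs (λ i → ≈ₗ⇒≋ (cs′ i) (cs i) (proj₂ (proj₂ (cs∈ i)))) f′≋f g′≋g)
        (R.trans (R.sym (relationₗ≋relation (suc d) cs f g)) (≈ₗ⇒≋ _ [] eq)))
    h = proj₁ quotient

  -- A nilpotent x would make x/s integral, forcing x = 0 by comparing constant coefficients.
  normal⇒reduced : ∀ {Q} → Q (toℚⁿ 0ℤᵥ) → Normal Q → Reduced
  normal⇒reduced {Q} origin normal x x²≈0
    with normal {monomial x 0ₑ} {x^ (0ℤᵥ , 1)} ([] ∷ []) (generator 0ℤᵥ origin ∷ []) (x^≉0 _)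
           -- The polynomial is X², of degree `suc 1`.
           1 {λ _ → []} (λ _ → [])
           (extensional λ φ → K.trans (K.+-identityʳ _) (K.trans (K.*-congʳ (K.trans (K.*-congˡ (K.*-identityʳ x)) x²≈0)) (K.zeroˡ _)))
  ... | h , _ , eq = begin
    x                                     ≈⟨ K.sym (coeff-monomial x 0ₑ) ⟩
    coeff (monomial x 0ₑ) 0ₑ              ≈⟨ ≋⇒≈ₗ eq 0ₑ ⟩
    coeff (h *ₗ x^ (0ℤᵥ , 1)) 0ₑ          ≈⟨ ≋⇒≈ₗ (R.*-comm h (x^ (0ℤᵥ , 1))) 0ₑ ⟩
    coeff (x^ (0ℤᵥ , 1) *ₗ h) 0ₑ          ≈⟨ coeff-absent (Supp-* {P = λ e → e ≡ (0ℤᵥ , 1)} {S = λ e → ¬ e ≡ 0ₑ}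
                                                (λ { refl _ () }) (refl ∷ []) (All.universal id h)) ⟩
    0#                                    ∎
    where open SetoidReasoning K.setoid

  module _ (reduced : Reduced) {d : ℕ} {cs : Fin (suc d) → LP} {g : LP} where

    LightFor : Exp → Set c
    LightFor e = Σ Weight λ W → Σ ℤ λ θ →
      (∀ i → MonomialOrder.Heavy W (+ (suc d ℕ.∸ toℕ i) ℤ.* θ) (cs i)) × Weight.weight W e ℤ.< θ

    -- Each bad term brings its own weight and threshold. Filtering by them removes at least that
    -- term, possibly good ones too, and leaves h g unchanged. As `LightFor` does not depend on h,
    -- the survivors remain classified and the process repeats.
    prune : ∀ {Good : Exp → Set} h → Supp (λ e → Good e ⊎ LightFor e) h → relation (suc d) cs (h *ₗ g) g ≋ [] →
            ∃ λ h′ → Supp Good h′ × h *ₗ g ≋ h′ *ₗ g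
    prune {Good} h = go (L.length h) h ℕP.≤-refl
      where
      split : ∀ h → Supp (λ e → Good e ⊎ LightFor e) h → Supp Good h ⊎ Any (LightFor ∘ proj₂) h
      split []      []                   = inj₁ []
      split (t ∷ h) (inj₂ light ∷ _)     = inj₂ (here light)
      split (t ∷ h) (inj₁ good ∷ classified) = Sum.map (good ∷_) there (split h classified)

      go : ∀ m h → L.length h ℕ.≤ m → Supp (λ e → Good e ⊎ LightFor e) h → relation (suc d) cs (h *ₗ g) g ≋ [] →
           ∃ λ h′ → Supp Good h′ × h *ₗ g ≋ h′ *ₗ g
      go zero    []      len classified eq = [] , [] , R.refl
      go (suc m) h       len classified eq with split h classified
      ... | inj₁ good  = h , good , R.refl
      ... | inj₂ light with find light
      ...   | t , t∈h , W , θ , heavy , t<θ = proj₁ rec , proj₁ (proj₂ rec) , R.trans drop (proj₂ (proj₂ rec))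
        where
        open MonomialOrder W
        open Light reduced d cs θ heavy
        h′ = L.filter heavy? h
        drop : h *ₗ g ≋ h′ *ₗ g
        drop = discard-light g h eq
        len′ : L.length h′ ℕ.≤ m
        len′ = ℕ.s≤s⁻¹ (ℕP.≤-trans (ListP.filter-notAll heavy? h (lose t∈h (ℤP.<⇒≱ t<θ))) len)
        rec = go m h′ len′ (AllP.filter⁺ heavy? classified)
          (R.trans (relation-cong (suc d) cs cs (λ i → R.refl) (R.sym drop) (R.refl {g})) eq)

  -- Transfer of normality between P and P±

  module Transfer (P : ℚⁿ n → Set) (antiBlocking : AntiBlocking P) (origin : P (toℚⁿ 0ℤᵥ)) where
    open AntiBlockingMonoid P antiBlocking

    degree-InMonoid : ∀ k → InMonoid P (0ℤᵥ , k)
    degree-InMonoid zero    = []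
    degree-InMonoid (suc k) = subst (λ z → InMonoid P (z , suc k)) (VP.zipWith-identityˡ ℤP.+-identityˡ 0ℤᵥ)
      (origin ∷ degree-InMonoid k)

    multiple-≥ : ∀ N (b : Vec ℤ n) → Nonneg b → b ≤ᵥ + suc N ⊛ b
    multiple-≥ N b 0≤b i = subst (V.lookup b i ℤ.≤_) (sym (VP.lookup-map i (+ suc N ℤ.*_) b)) (bound (V.lookup b i) (0≤b i))
      where
      bound : ∀ z → ℤ.0ℤ ℤ.≤ z → z ℤ.≤ + suc N ℤ.* z
      bound (+ z) _ = subst (+ z ℤ.≤_) (ℤP.pos-* (suc N) z) (ℤ.+≤+ (ℕP.m≤m+n z (N ℕ.* z)))

    present : ∀ {Q : Exp → Set} {p e} → Supp Q p → coeff p e ≈ 1# → Q e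
    present {p = []}          []       eq = ⊥-elim (K.0≉1 eq)
    present {p = (a , e′) ∷ p} {e} (q ∷ qs) eq with e′ ≟ₑ e
    ... | yes refl = q
    ... | no _     = present qs eq

    -- If N t ∈ M for the monomial t = x^b s^k, then t = (x^b s^(Nk)) / s^((N-1)k) is a root
    -- of X^N - t^N, with numerator and denominator in K[P].
    normal⇒saturated : Normal P → Saturated
    normal⇒saturated normal N {e@(b , k)} 0≤b m = member
      where
      e′ = (0ℤᵥ , N ℕ.* k)
      D  = suc N
      cs : Fin D → LP
      cs zero    = monomial (K.- 1#) (D ×ₑ e)
      cs (suc i) = []
      cs∈ : ∀ i → Supp (InMonoid P) (cs i)
      cs∈ zero    = m ∷ []
      cs∈ (suc i) = []
      -- The denominator is s^(N k) and the numerator x^b s^(D k) with D = N + 1. The latter lies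
      -- below the given member (D b, D k) of M, as b ≥ 0.
      numerator∈ : InMonoid P (e +ₑ e′)
      numerator∈ = subst (λ z → InMonoid P (z , D ℕ.* k)) (sym (VP.zipWith-identityʳ ℤP.+-identityʳ b))
        (InMonoid-down (subst (InMonoid P) (×ₑ≡ D b k) m) b 0≤b (multiple-≥ N b 0≤b))
      Σ-zero : ∀ j (F : Fin j → LP) → (∀ i → F i ≡ []) → sum F ≋ []
      Σ-zero zero    F eq = R.refl
      Σ-zero (suc j) F eq = ++-cong (≋-reflexive (eq zero)) (Σ-zero j (F ∘ suc) (eq ∘ suc))
      root : relation D cs (x^ (e +ₑ e′)) (x^ e′) ≋ []
      root = R.trans (++-cong (R.refl {x^ (e +ₑ e′) RE.^ D})
                (++-cong (R.refl {term D cs (x^ (e +ₑ e′)) (x^ e′) zero}) (Σ-zero N _ (λ i → refl))))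
        (extensional λ φ → begin
          eval ((x^ (e +ₑ e′) RE.^ D) ++ (constant ++ [])) φ
            ≈⟨ eval-++ (x^ (e +ₑ e′) RE.^ D) (constant ++ []) φ ⟩
          eval (x^ (e +ₑ e′) RE.^ D) φ + eval (constant ++ []) φ
            ≈⟨ K.+-cong (eval-x^-^ (e +ₑ e′) D φ) (K.trans (eval-++ constant [] φ) (K.+-identityʳ _)) ⟩
          φ (D ×ₑ (e +ₑ e′)) + eval constant φ
            ≈⟨ K.+-congˡ (eval-monomial-* (K.- 1#) (D ×ₑ e) (1ₗ *ₗ (x^ e′ RE.^ D)) φ) ⟩
          φ (D ×ₑ (e +ₑ e′)) + (K.- 1#) * eval (1ₗ *ₗ (x^ e′ RE.^ D)) (λ z → φ ((D ×ₑ e) +ₑ z))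
            ≈⟨ K.+-congˡ (K.*-congˡ (K.trans (at (R.*-identityˡ (x^ e′ RE.^ D)) _) (eval-x^-^ e′ D _))) ⟩
          φ (D ×ₑ (e +ₑ e′)) + (K.- 1#) * φ ((D ×ₑ e) +ₑ (D ×ₑ e′))
            ≈⟨ K.+-cong (K.reflexive (cong φ (×ₑ-distrib-+ₑ D e e′))) (-1*x≈-x _) ⟩
          φ ((D ×ₑ e) +ₑ (D ×ₑ e′)) + K.- φ ((D ×ₑ e) +ₑ (D ×ₑ e′))
            ≈⟨ K.-‿inverseʳ _ ⟩
          0# ∎)
        where
        open SetoidReasoning K.setoid
        constant = term D cs (x^ (e +ₑ e′)) (x^ e′) zero
      quotient : ∃ λ h → Supp (InMonoid P) h × x^ (e +ₑ e′) ≋ h *ₗ x^ e′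
      quotient = normal (numerator∈ ∷ []) (degree-InMonoid (N ℕ.* k) ∷ []) (x^≉0 _) N {cs} cs∈ root
      h = proj₁ quotient
      -- Comparing coefficients in the quotient equation gives h the coefficient 1 at e, so e occurs
      -- in h.
      member : InMonoid P e
      member = present (proj₁ (proj₂ quotient)) (begin
        coeff h e                                  ≈⟨ K.sym (coeff-x^-* e′ h e) ⟩
        coeff (x^ e′ *ₗ h) (e′ +ₑ e)               ≈⟨ ≋⇒≈ₗ (R.*-comm (x^ e′) h) (e′ +ₑ e) ⟩
        coeff (h *ₗ x^ e′) (e′ +ₑ e)               ≈⟨ K.sym (≋⇒≈ₗ (proj₂ (proj₂ quotient)) (e′ +ₑ e)) ⟩
        coeff (x^ (e +ₑ e′)) (e′ +ₑ e)             ≈⟨ K.reflexive (cong (coeff (x^ (e +ₑ e′))) (+ₑ-comm e′ e)) ⟩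
        coeff (x^ (e +ₑ e′)) (e +ₑ e′)             ≈⟨ coeff-monomial 1# (e +ₑ e′) ⟩
        1#                                         ∎)
        where open SetoidReasoning K.setoid

    origin± : (P ^±) (toℚⁿ 0ℤᵥ)
    origin± = V.replicate n Sign.+ , toℚⁿ 0ℤᵥ , origin , trans (cong toℚⁿ (sym (signᵥ-0 (V.replicate n Sign.+)))) (toℚⁿ-signᵥ _ 0ℤᵥ)

    normal±⇒normal : Normal (P ^±) → Normal P
    normal±⇒normal normal {f} {g} f∈ g∈ g≉0 d {cs} cs∈ eq
      with normal (All.map InMonoid⇒InMonoid± f∈) (All.map InMonoid⇒InMonoid± g∈) g≉0 d {cs}
             (λ i → All.map InMonoid⇒InMonoid± (cs∈ i)) eq
    ... | h , h∈ , f≋hg with prune (normal⇒reduced origin± normal) {d} {cs} {g} h (All.map decide h∈)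
                               (R.trans (relation-cong (suc d) cs cs (λ i → R.refl) (R.sym f≋hg) (R.refl {g})) eq)
      where
      decide : ∀ {e} → InMonoid (P ^±) e → InMonoid P e ⊎ LightFor (normal⇒reduced origin± normal) {d} {cs} {g} e
      decide m = Sum.map₂ (λ { (W , nonneg , neg) → W , ℤ.0ℤ ,
        (λ i → All.map (λ m′ → ℤP.≤-trans (ℤP.≤-reflexive (ℤP.*-zeroʳ (+ (suc d ℕ.∸ toℕ i)))) (nonneg m′)) (cs∈ i)) , neg })
        (InMonoid±-decide m)
    ...   | h′ , h′∈ , hg≋h′g = h′ , h′∈ , R.trans f≋hg hg≋h′g

    -- Multiplication by this monomial moves all of p into K[P] at once: each exponent e of p meets
    -- its own ∣e∣ among the summands, and ∣e∣ + e lies in M like all the other summands.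
    bound : LP → Exp
    bound []                  = 0ₑ
    bound ((_ , (a , k)) ∷ p) = (absᵥ a , k) +ₑ bound p

    bound-InMonoid : ∀ {p} → Supp (InMonoid (P ^±)) p → InMonoid P (bound p)
    bound-InMonoid []       = []
    bound-InMonoid (m ∷ ms) = InMonoid-+ (InMonoid±⇒InMonoid m) (bound-InMonoid ms)

    bound-shift : ∀ {p} → Supp (InMonoid (P ^±)) p → Supp (λ e → InMonoid P (bound p +ₑ e)) p
    bound-shift []                            = []
    bound-shift {(_ , e@(a , k)) ∷ p} (m ∷ ms) =
      subst (InMonoid P) (trans (sym (+ₑ-assoc (bound p) _ e)) (cong (_+ₑ e) (+ₑ-comm (bound p) _)))
        (InMonoid-+ (bound-InMonoid ms) (shift-InMonoid m)) ∷
      All.map (λ {t} m′ → subst (InMonoid P) (sym (+ₑ-assoc (absᵥ a , k) (bound p) (proj₂ t)))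
        (InMonoid-+ (InMonoid±⇒InMonoid m) m′)) (bound-shift ms)

    Supp-Σ⁻ : ∀ {Q : Exp → Set} {m} (F : Fin m → LP) → Supp Q (sum F) → ∀ i → Supp Q (F i)
    Supp-Σ⁻ F s zero    = AllP.++⁻ˡ (F zero) s
    Supp-Σ⁻ F s (suc i) = Supp-Σ⁻ (F ∘ suc) (AllP.++⁻ʳ (F zero) s) i

    -- One of the r factors moves q into K[P]; the others are there already. This treats the twisted
    -- coefficients, where r = D - i is positive.
    x^-^-* : ∀ {y q} → InMonoid P y → Supp (λ e → InMonoid P (y +ₑ e)) q → ∀ r → 0 ℕ.< r →
             Supp (InMonoid P) ((x^ y RE.^ r) *ₗ q)
    x^-^-* {y} {q} y∈ q∈ (suc r) _ = Supp-* {P = λ e → ∃ λ e′ → e ≡ y +ₑ e′ × InMonoid P e′}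
      (λ { {e} {e″} (e′ , refl , m) m′ → subst (InMonoid P)
        (trans (sym (+ₑ-assoc e′ y e″)) (cong (_+ₑ e″) (+ₑ-comm e′ y))) (InMonoid-+ m m′) })
      (Supp-* {P = λ e → e ≡ y} {Q = InMonoid P} (λ { refl m → _ , refl , m }) (refl ∷ [])
        (Supp-^ {S = λ _ → InMonoid P} [] (λ m m′ → InMonoid-+ m m′) (y∈ ∷ []) r))
      q∈

    ShiftOf : Exp → Exp → Set
    ShiftOf y e = ∃ λ e′ → e ≡ y +ₑ e′ × InMonoid (P ^±) e′

    unshift : ∀ {y} p → Supp (ShiftOf y) p → ∃ λ q → Supp (InMonoid (P ^±)) q × x^ y *ₗ q ≋ p
    unshift []            []                       = [] , [] , R.refl
    unshift {y} ((a , e) ∷ p) ((e′ , refl , m) ∷ ms) with unshift {y} p ms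
    ... | q , q∈ , eq = (a , e′) ∷ q , m ∷ q∈ , extensional λ φ →
      K.trans (eval-x^-* y ((a , e′) ∷ q) φ) (K.+-congˡ (K.trans (K.sym (eval-x^-* y q φ)) (at eq φ)))

    subtract-shift : ∀ (a v : Vec ℤ n) {k l} → l ℕ.≤ k → (a , k) ≡ (v , l) +ₑ (V.zipWith ℤ._-_ a v , k ℕ.∸ l)
    subtract-shift a v l≤k = cong₂ _,_ (sym (undo a v)) (sym (ℕP.m+[n∸m]≡n l≤k))
      where
      undo₁ : ∀ x y → y ℤ.+ (x ℤ.- y) ≡ x
      undo₁ = solve-∀
      undo : ∀ {m} (a v : Vec ℤ m) → v ⊕ V.zipWith ℤ._-_ a v ≡ a
      undo []      []      = refl
      undo (x ∷ a) (y ∷ v) = cong₂ _∷_ (undo₁ x y) (undo a v)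

    -- With y a monomial so deep in the cone of P that y f, y g and y cᵢ lie in K[P], the
    -- fraction y (f/g) is integral over K[P].  Its value there is y h up to terms that are
    -- killed by g, since they are not y times a monomial of the cone of P±.
    normal⇒normal± : (∀ e → InMonoid (P ^±) e ⊎ Separated (P ^±) e) → Normal P → Normal (P ^±)
    normal⇒normal± decide normal {f} {g} f∈ g∈ g≉0 d {cs} cs∈ eq = h , h∈ , x^-cancel y (begin
      Y *ₗ f            ≈⟨ Yf≋pg ⟩
      p *ₗ g            ≈⟨ pg≋p′g ⟩
      p′ *ₗ g           ≈⟨ *ₗ-cong (R.sym Yh≋p′) (R.refl {g}) ⟩
      (Y *ₗ h) *ₗ g     ≈⟨ R.*-assoc Y h g ⟩
      Y *ₗ (h *ₗ g)     ∎)
      where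
      open SetoidReasoning R.setoid
      reduced = normal⇒reduced origin normal
      everything = f ++ (g ++ sum cs)
      everything∈ : Supp (InMonoid (P ^±)) everything
      everything∈ = AllP.++⁺ f∈ (AllP.++⁺ g∈ (Supp-Σ cs∈))
      y  = bound everything
      Y  = x^ y
      D  = suc d
      y∈ : InMonoid P y
      y∈ = bound-InMonoid everything∈
      shifted : Supp (λ e → InMonoid P (y +ₑ e)) everything
      shifted = bound-shift everything∈
      times-Y : ∀ {q} → Supp (λ e → InMonoid P (y +ₑ e)) q → Supp (InMonoid P) (Y *ₗ q)
      times-Y = Supp-* {P = λ e → e ≡ y} (λ { refl m → m }) (refl ∷ [])
      C = twist D Y cs
      C∈ : ∀ i → Supp (InMonoid P) (C i)
      C∈ i = x^-^-* y∈ (Supp-Σ⁻ cs (AllP.++⁻ʳ g (AllP.++⁻ʳ f shifted)) i) (D ℕ.∸ toℕ i) (ℕP.m<n⇒0<n∸m (FinP.toℕ<n i))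
      -- The fraction (Y f) / g is expanded by Y once more, so that its denominator lies in K[P] as
      -- well.
      F∈ : Supp (InMonoid P) (Y *ₗ (Y *ₗ f))
      F∈ = times-Y (All.map (InMonoid-+ y∈) (times-Y (AllP.++⁻ˡ f shifted)))
      G∈ : Supp (InMonoid P) (Y *ₗ g)
      G∈ = times-Y (AllP.++⁻ˡ g (AllP.++⁻ʳ f shifted))
      G≉0 : ¬ Y *ₗ g ≋ []
      G≉0 eq′ = g≉0 (x^-cancel y (R.trans eq′ (R.sym (R.zeroʳ Y))))
      root : relation D C (Y *ₗ f) g ≋ []
      root = begin
        relation D C (Y *ₗ f) g           ≈⟨ relation-twist D cs Y f g ⟩
        (Y RE.^ D) *ₗ relation D cs f g   ≈⟨ *ₗ-cong (R.refl {Y RE.^ D}) eq ⟩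
        (Y RE.^ D) *ₗ []                  ≈⟨ R.zeroʳ (Y RE.^ D) ⟩
        []                                ∎
      root′ : relation D C (Y *ₗ (Y *ₗ f)) (Y *ₗ g) ≋ []
      root′ = begin
        relation D C (Y *ₗ (Y *ₗ f)) (Y *ₗ g)     ≈⟨ relation-homogeneous D C Y (Y *ₗ f) g ⟩
        (Y RE.^ D) *ₗ relation D C (Y *ₗ f) g     ≈⟨ *ₗ-cong (R.refl {Y RE.^ D}) root ⟩
        (Y RE.^ D) *ₗ []                          ≈⟨ R.zeroʳ (Y RE.^ D) ⟩
        []                                        ∎
      quotient : ∃ λ p → Supp (InMonoid P) p × Y *ₗ (Y *ₗ f) ≋ p *ₗ (Y *ₗ g)
      quotient = normal F∈ G∈ G≉0 d {C} C∈ root′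
      p = proj₁ quotient
      Yf≋pg : Y *ₗ f ≋ p *ₗ g
      Yf≋pg = x^-cancel y (R.trans (proj₂ (proj₂ quotient)) (x∙yz≈y∙xz p Y g))
      -- The threshold is the weight of y: the twisted coefficient Y^(D - i) cᵢ weighs at least D -
      -- i times that, since cᵢ has nonnegative weight.
      light : ∀ {e} (W : Weight) → (∀ {e′} → InMonoid (P ^±) e′ → ℤ.0ℤ ℤ.≤ Weight.weight W e′) →
              Weight.weight W e ℤ.< Weight.weight W y → LightFor reduced {d} {C} {g} e
      light W nonneg e<y = W , Weight.weight W y , heavy , e<y
        where
        open MonomialOrder W
        heavy : ∀ i → Heavy (+ (D ℕ.∸ toℕ i) ℤ.* Weight.weight W y) (C i)
        heavy i = subst (λ w → Heavy w (C i)) (ℤP.+-identityʳ _)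
          (Heavy-* (Heavy-^ (ℤP.≤-refl ∷ []) (D ℕ.∸ toℕ i)) (All.map nonneg (cs∈ i)))
      classify : ∀ e → ShiftOf y e ⊎ LightFor reduced {d} {C} {g} e
      classify (a , k) with proj₂ y ℕ.≤? k
      -- Exponents of s are natural numbers, so e - y need not exist; the degree in s is then the
      -- separating weight. Otherwise a weight negative at e - y makes e lighter than y.
      ... | no  l≰k = inj₂ (light degreeWeight (λ _ → ℤ.+≤+ ℕ.z≤n) (ℤ.+<+ (ℕP.≰⇒> l≰k)))
      ... | yes l≤k with decide (V.zipWith ℤ._-_ a (proj₁ y) , k ℕ.∸ proj₂ y)
      ...   | inj₁ m = inj₁ (_ , subtract-shift a (proj₁ y) l≤k , m)
      ...   | inj₂ (W , nonneg , neg) = inj₂ (light W nonneg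
                (subst (ℤ._< weight y) (sym (trans (cong weight (subtract-shift a (proj₁ y) l≤k)) (weight-+ y _)))
                  (subst (weight y ℤ.+ weight (V.zipWith ℤ._-_ a (proj₁ y) , k ℕ.∸ proj₂ y) ℤ.<_) (ℤP.+-identityʳ (weight y))
                    (ℤP.+-monoʳ-< (weight y) neg))))
        where open Weight W
      pruned : ∃ λ p′ → Supp (ShiftOf y) p′ × p *ₗ g ≋ p′ *ₗ g
      pruned = prune reduced {d} {C} {g} p (All.universal (λ t → classify (proj₂ t)) p)
        (R.trans (relation-cong D C C (λ i → R.refl) (R.sym Yf≋pg) (R.refl {g})) root)
      p′ = proj₁ pruned
      pg≋p′g : p *ₗ g ≋ p′ *ₗ g
      pg≋p′g = proj₂ (proj₂ pruned)
      unshifted = unshift {y} p′ (proj₁ (proj₂ pruned))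
      h = proj₁ unshifted
      h∈ : Supp (InMonoid (P ^±)) h
      h∈ = proj₁ (proj₂ unshifted)
      Yh≋p′ : Y *ₗ h ≋ p′
      Yh≋p′ = proj₂ (proj₂ unshifted)

theorem1p1 : ∀ {c ℓ} (K : Field c ℓ) (n m : ℕ) (vs : Vec (Vec ℤ n) m) →
    AntiBlocking (Conv vs) → HasDim (Conv vs) →
    (Laurent.IsNormal K n (Conv vs) ⇔ Laurent.IsNormal K n ((Conv vs) ^±))
theorem1p1 K n m vs antiBlocking (p , p∈ , _) = mk⇔
  (λ normal → let normal′ = IsNormal⇒Normal normal in
    Normal⇒IsNormal (normal⇒normal± (cone-decide (normal⇒saturated normal′)) normal′))
  (λ normal± → Normal⇒IsNormal (normal±⇒normal (IsNormal⇒Normal normal±)))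
  where
  open Normality K n
  open Monoids K n
  open AntiBlockingMonoid (Conv vs) antiBlocking using (P-origin)
  open Cone vs antiBlocking
  -- Lowering all coordinates of the point `p zero` to 0 puts the origin into the polytope.
  open Transfer (Conv vs) antiBlocking (P-origin (p∈ zero))
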